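{- Let $n\ge 3$, let $M,N\in\mathbb{Z}^{n-1}$ and let $D=(D_1,\dots,D_{n-1})$ be a tuple of positive integers. If $D_{n-1}=1$, then the long Weyl element Kloosterman sums satisfy $$S_n(M,N;D)=S_{n-1}\big((M_1,\dots,M_{n-2}),(N_1,\dots,N_{n-2});(D_1,\dots,D_{n-2})\big).$$
   Context: Definition of $S_n(M,N;D)$ for any $n\ge2$, $M,N\in\mathbb{Z}^{n-1}$ and $D$ an $(n-1)$-tuple of positive integers: $e(z)=e^{2\pi i z}$. $U$ is the group of upper triangular unipotent $n\times n$ matrices. For $N\in\mathbb{Z}^{n-1}$, $\psi_N$ is the character of $U(\mathbb{R})$, trivial on $U(\mathbb{Z})$, given by $\psi_N(u)=e(N_1u_{1,2}+N_2u_{2,3}+\cdots+N_{n-1}u_{n-1,n})$. For $M\in \mathbb{Z}^{n-1}$, $\tilde M=(M_{n-1},\dots,M_1)$. Let $w_0$ be the long Weyl element: the $n\times n$ matrix whose only nonzero entries are on the anti-diagonal, the entry at position $(n-k+1,k)$ being $(-1)^{k-1}$ ($1\le k\le n$). Let $c=\mathrm{Diag}(1/D_{n-1},\,D_{n-1}/D_{n-2},\dots,D_2/D_1,\,D_1)$, $C(c)=U(\mathbb{R})\,c\,w_0\,U(\mathbb{R})\cap SL(n,\mathbb{Z})$ and $X(c)=U(\mathbb{Z})\backslash C(c)/U(\mathbb{Z})$. Each $\gamma\in C(c)$ is uniquely $\gamma=b_1cw_0b_2$ with $b_1,b_2\in U(\mathbb{R})$; set $\mu(\gamma)=b_1\in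 U(\mathbb{Z})\backslash U(\mathbb{R})$ and $\mu'(\gamma)=b_2\in U(\mathbb{R})/U(\mathbb{Z})$. Then $$S_n(M,N;D)=\sum_{x\in X(c)}\psi_{\tilde M}(\mu(x))\,\psi_N(\mu'(x)).$$ -}

module Defs where

open import Level using (Level; _⊔_) renaming (suc to lsuc)
open import Algebra.Bundles using (CommutativeRing)
open import Algebra.Apartness.Bundles using (HeytingField)
import Algebra.Definitions.RawMonoid as RawMonoidDefs
import Algebra.Properties.Semiring.Exp as Exp
open import Data.Nat.Base as ℕ using (ℕ; NonZero)
open import Data.Integer.Base as ℤ using (ℤ; +_; -[1+_])
import Data.Integer.Properties as ℤ
open import Data.Fin.Base using (Fin; zero; suc; toℕ; inject₁; opposite; punchIn; _<_)
open import Data.Fin.Properties using (_≟_)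
open import Data.Vec.Functional using (Vector; _∷_; reverse)
open import Data.Product.Base using (∃-syntax; _×_; proj₁)
open import Data.Bool.Base using (if_then_else_)
open import Function.Bundles using (_⇔_)
open import Function.Definitions using (Bijective)
open import Relation.Nullary.Decidable using (⌊_⌋)
open import Relation.Binary.PropositionalEquality using (_≡_)

infixl 5 _∷ʳ_

_∷ʳ_ : ∀ {a} {A : Set a} {r} → Vector A r → A → Vector A (ℕ.suc r)
_∷ʳ_ {r = ℕ.zero}  xs y _       = y
_∷ʳ_ {r = ℕ.suc r} xs y zero    = xs zero
_∷ʳ_ {r = ℕ.suc r} xs y (suc i) = ((λ j → xs (suc j)) ∷ʳ y) i

module Matrices {c ℓ} (R : CommutativeRing c ℓ) where

  open CommutativeRing R hiding (zero)
  open RawMonoidDefs +-rawMonoid using (sum)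
  open Exp semiring using (_^_)

  infixl 7 _·_
  infix  4 _≋_

  Matrix : ℕ → Set c
  Matrix n = Fin n → Fin n → Carrier

  _≋_ : ∀ {n} → Matrix n → Matrix n → Set ℓ
  A ≋ B = ∀ i j → A i j ≈ B i j

  _·_ : ∀ {n} → Matrix n → Matrix n → Matrix n
  (A · B) i j = sum λ k → A i k * B k j

  diag : ∀ {n} → Vector Carrier n → Matrix n
  diag d i j = if ⌊ i ≟ j ⌋ then d i else 0#

  -- Laplace expansion along the first row.
  det : ∀ {n} → Matrix n → Carrier
  det {ℕ.zero}  A = 1#
  det {ℕ.suc n} A =
    sum λ j → (- 1#) ^ toℕ j * (A zero j * det (λ k l → A (suc k) (punchIn j l)))

  IsUpperUnipotent : ∀ {n} → Matrix n → Set ℓ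
  IsUpperUnipotent u = (∀ i → u i i ≈ 1#) × (∀ i j → j < i → u i j ≈ 0#)

  -- With rows and columns numbered from 0, the entry of column k sits in
  -- row n-1-k and is (-1)^k.
  longWeyl : ∀ {n} → Matrix n
  longWeyl i k = if ⌊ i ≟ opposite k ⌋ then (- 1#) ^ toℕ k else 0#

module ℤᴹ = Matrices ℤ.+-*-commutativeRing

toRing : ∀ {c ℓ₁ ℓ₂} → HeytingField c ℓ₁ ℓ₂ → CommutativeRing c ℓ₁
toRing F = record { isCommutativeRing = HeytingField.isCommutativeRing F }

module _ {c ℓ₁ ℓ₂} (F : HeytingField c ℓ₁ ℓ₂) where

  open HeytingField F
  open RawMonoidDefs (CommutativeRing.+-rawMonoid (toRing F)) using () renaming (_×_ to _×′_)

  fromℤ : ℤ → Carrier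
  fromℤ (+ n)    = n ×′ 1#
  fromℤ -[1+ n ] = - (ℕ.suc n ×′ 1#)

  CharacteristicZero : Set ℓ₂
  CharacteristicZero = ∀ n → .{{NonZero n}} → fromℤ (+ n) # 0#

-- The number systems: R plays the role of ℝ, C that of ℂ, and e that of
-- z ↦ exp(2πiz).  Only the algebraic properties listed here are used:
-- characteristic zero, and that e is a homomorphism from (R,+) to the
-- multiplicative group of C with kernel exactly ℤ.  (ℝ, ℂ, exp(2πi·)) is one
-- instance.
record Exponential (c ℓ₁ ℓ₂ c′ ℓ₁′ ℓ₂′ : Level)
       : Set (lsuc (c ⊔ ℓ₁ ⊔ ℓ₂ ⊔ c′ ⊔ ℓ₁′ ⊔ ℓ₂′)) where
  field
    R : HeytingField c ℓ₁ ℓ₂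
    C : HeytingField c′ ℓ₁′ ℓ₂′

  module R = HeytingField R
  module C = HeytingField C

  field
    R-char0  : CharacteristicZero R
    C-char0  : CharacteristicZero C
    e        : R.Carrier → C.Carrier
    e-cong   : ∀ {x y} → x R.≈ y → e x C.≈ e y
    e-homo   : ∀ x y → e (x R.+ y) C.≈ e x C.* e y
    e-kernel : ∀ x → e x C.≈ C.1# ⇔ (∃[ m ] x R.≈ fromℤ R m)

module Kloosterman {c ℓ₁ ℓ₂ c′ ℓ₁′ ℓ₂′} (E : Exponential c ℓ₁ ℓ₂ c′ ℓ₁′ ℓ₂′) where

  open Exponential E public

  module Rᴹ = Matrices (toRing R)

  open RawMonoidDefs (CommutativeRing.+-rawMonoid (toRing R)) using () renaming (sum to sumᴿ)
  open RawMonoidDefs (CommutativeRing.+-rawMonoid (toRing C)) using () renaming (sum to sumᶜ)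

  ι : ℤ → R.Carrier
  ι = fromℤ R

  ψ : ∀ {r} → Vector ℤ r → Rᴹ.Matrix (ℕ.suc r) → C.Carrier
  ψ N u = e (sumᴿ λ i → ι (N i) R.* u (inject₁ i) (suc i))

  -- #⇒invertible yields an inverse of d - 0.
  reciprocal : ∀ d → NonZero d → R.Carrier
  reciprocal d nz = proj₁ (R.#⇒invertible (R-char0 d {{nz}}))

  module _ {r} (D : Vector ℕ r) (D⁺ : ∀ i → NonZero (D i)) where

    private
      n = ℕ.suc r

    1∷D⁺ : ∀ j → NonZero ((1 ∷ D) j)
    1∷D⁺ zero    = _
    1∷D⁺ (suc j) = D⁺ j

    -- With D₀ = Dₙ = 1, the diagonal entries read from the bottom right corner
    -- upwards are D₁/D₀, D₂/D₁, …, Dₙ/Dₙ₋₁.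
    cᴰ : Rᴹ.Matrix n
    cᴰ = Rᴹ.diag (reverse λ j → ι (+ (D ∷ʳ 1) j) R.* reciprocal ((1 ∷ D) j) (1∷D⁺ j))

    -- b₁ and b₂ are uniquely determined by γ, so carrying them as fields adds
    -- no data.
    record BruhatCell : Set (c ⊔ ℓ₁) where
      field
        γ            : ℤᴹ.Matrix n
        γ-det        : ℤᴹ.det γ ≡ + 1
        b₁ b₂        : Rᴹ.Matrix n
        b₁-unipotent : Rᴹ.IsUpperUnipotent b₁
        b₂-unipotent : Rᴹ.IsUpperUnipotent b₂
        bruhat       : (λ i j → ι (γ i j)) Rᴹ.≋ b₁ Rᴹ.· cᴰ Rᴹ.· Rᴹ.longWeyl Rᴹ.· b₂

    open BruhatCell

    infix 4 _∼_

    _∼_ : BruhatCell → BruhatCell → Set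
    x ∼ y = ∃[ u ] ∃[ v ] ℤᴹ.IsUpperUnipotent u × ℤᴹ.IsUpperUnipotent v
                        × γ y ℤᴹ.≋ u ℤᴹ.· γ x ℤᴹ.· v

    -- An enumeration without repetition of the finite set
    -- X(c) = U(ℤ)\C(c)/U(ℤ) by representatives in C(c).
    record Enumeration : Set (c ⊔ ℓ₁) where
      field
        size      : ℕ
        rep       : Fin size → BruhatCell
        bijective : Bijective _≡_ _∼_ rep

    -- The sum over X(c), read off an arbitrary enumeration; each summand depends
    -- only on the double coset because ψ is trivial on U(ℤ).
    S : Enumeration → Vector ℤ r → Vector ℤ r → C.Carrier
    S X M N = sumᶜ λ i → ψ (reverse M) (b₁ (rep i)) C.* ψ N (b₂ (rep i))
      where open Enumeration X

{-# OPTIONS --safe #-}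
module Submission where

-- With D_{n-1} = 1, the lower left (n-1)×(n-1) block A of γ ∈ C(c) satisfies
-- A = b₁′ c′w₀′ b₂′, where b₁′ drops the first row and column of b₁ and b₂′ the
-- last ones of b₂, and det A = det γ = 1.  So A is invertible over ℤ, and
-- integral unipotent matrices bring γ to the form (0 ±1; A 0).  Hence γ ↦ A
-- induces a bijection of X(c) with the corresponding set for (D₁,…,D_{n-2}).
-- By uniqueness of the Bruhat decomposition, the summand is constant on double
-- cosets; at (0 ±1; A 0) one has b₁ = diag(1, b₁′) and b₂ = diag(b₂′, 1), so it
-- equals the summand of A.

open import Level using (Level; _⊔_)
open import Algebra.Apartness.Bundles using (HeytingField)
open import Algebra.Bundles using (CommutativeRing)
import Algebra.Properties.CommutativeSemigroup as CommutativeSemigroupProperties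
import Algebra.Properties.Ring as RingProperties
import Algebra.Properties.Semiring.Exp as Exp
import Algebra.Properties.Semiring.Mult as Mult
import Algebra.Properties.Semiring.Sum as Sum
open import Data.Bool.Base using (if_then_else_)
open import Data.Fin.Base
  using (Fin; zero; suc; toℕ; fromℕ; inject₁; opposite; punchIn; _<_; _≤_)
open import Data.Fin.Permutation using (Permutation; permutation; _⟨$⟩ʳ_)
open import Data.Fin.Properties as Fin using (_≟_; suc-injective; toℕ-fromℕ; toℕ-inject₁)
open import Data.Fin.Relation.Unary.Top using (view; ‵fromℕ; ‵inject₁)
open import Data.Integer.Base as ℤ using (ℤ; +_; -[1+_])
import Data.Integer.Properties as ℤ
open import Data.Nat.Base as ℕ using (ℕ; NonZero; z≤n; s≤s; z<s; s<s)
import Data.Nat.Properties as ℕ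
open import Data.Product.Base using (∃-syntax; _×_; _,_; proj₁; proj₂)
open import Data.Vec.Functional using (Vector; _∷_; init; last; tail; reverse; updateAt)
open import Data.Vec.Functional.Properties using (updateAt-updates; updateAt-minimal)
open import Function.Base using (_∘_; const)
open import Function.Bundles using (Equivalence)
open import Function.Definitions using (Bijective)
open import Relation.Binary.Bundles using (Setoid)
open import Relation.Binary.Core using (Rel)
open import Relation.Binary.Definitions using (tri<; tri≈; tri>)
open import Relation.Binary.PropositionalEquality as ≡ using (_≡_; _≢_)
import Relation.Binary.Reasoning.Setoid as SetoidReasoning
open import Relation.Nullary.Decidable using (Dec; yes; no; ⌊_⌋)
open import Relation.Nullary.Negation using (¬_; contradiction)
open import Defs

-- The hypothesis acts on `c`: its top left entry 1/D_{n-1} is 1, and the next one, D_{n-1}/D_{n-2},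
-- becomes 1/D_{n-2}, the top left entry of `c′`. So `c w₀` has `c′w₀′` as its lower left block and,
-- besides it, only the entry (-1)^(n-1) in the upper right corner. That entry is also the sign of
-- its cofactor, which is why passing between `A` and (0 ±1; A 0) keeps the determinant. The
-- characters match because `M` enters in reversed order: b₁ loses its first row, paired with
-- M_{n-1}, and b₂ its last column, paired with N_{n-1}. The determinant is an expansion along the
-- first row, and the argument stays with rows: linearity and alternation in the rows give
-- invariance under unipotent factors on the left, and the adjugate gives a right inverse. Unipotent
-- factors on the right are absorbed by the shape of the first row of (0 ±1; A 0), and that the
-- right inverse of `A` is also a left inverse is read off the Bruhat factorisation of `A` over `R`.

private variable n : ℕ

-- Indices: the last position, reversal, removal of columns

if-yes : ∀ {a p} {A : Set a} {P : Set p} (P? : Dec P) {x y : A} → P → (if ⌊ P? ⌋ then x else y) ≡ x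
if-yes (yes _) _ = ≡.refl
if-yes (no ¬p) p = contradiction p ¬p

if-no : ∀ {a p} {A : Set a} {P : Set p} (P? : Dec P) {x y : A} → ¬ P → (if ⌊ P? ⌋ then x else y) ≡ y
if-no (yes p) ¬p = contradiction p ¬p
if-no (no _)  _  = ≡.refl

∷ʳ-init : ∀ {a} {A : Set a} (xs : Vector A n) y i → (xs ∷ʳ y) (inject₁ i) ≡ xs i
∷ʳ-init {n = ℕ.suc n} xs y zero    = ≡.refl
∷ʳ-init {n = ℕ.suc n} xs y (suc i) = ∷ʳ-init (tail xs) y i

∷ʳ-last : ∀ {a} {A : Set a} (xs : Vector A n) y → (xs ∷ʳ y) (fromℕ n) ≡ y
∷ʳ-last {n = ℕ.zero}  xs y = ≡.refl
∷ʳ-last {n = ℕ.suc n} xs y = ∷ʳ-last (tail xs) y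

-- The blocks in play drop the last column, whereas pattern matching on `Fin` splits at the first
-- element; `view` supplies the split at the last one.
∀-last : ∀ {p} {P : Fin (ℕ.suc n) → Set p} → (∀ i → P (inject₁ i)) → P (fromℕ n) → ∀ i → P i
∀-last init′ last′ i with view i
... | ‵fromℕ     = last′
... | ‵inject₁ j = init′ j

opposite-inject₁ : ∀ (i : Fin n) → opposite (inject₁ i) ≡ suc (opposite i)
opposite-inject₁ zero    = ≡.refl
opposite-inject₁ (suc i) = ≡.cong inject₁ (opposite-inject₁ i)

opposite-fromℕ : ∀ n → opposite (fromℕ n) ≡ zero
opposite-fromℕ ℕ.zero    = ≡.refl
opposite-fromℕ (ℕ.suc n) = ≡.cong inject₁ (opposite-fromℕ n)

opposite-mono-< : ∀ {i j : Fin n} → i < j → opposite j < opposite i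
opposite-mono-< {n} {i} {j} i<j
  rewrite Fin.opposite-prop i | Fin.opposite-prop j =
  ℕ.∸-monoʳ-< (s<s i<j) (Fin.toℕ<n j)

inject₁<fromℕ : ∀ (i : Fin n) → inject₁ i < fromℕ n
inject₁<fromℕ {n} i rewrite toℕ-inject₁ i | toℕ-fromℕ n = Fin.toℕ<n i

punchIn-fromℕ : ∀ (i : Fin n) → punchIn (fromℕ n) i ≡ inject₁ i
punchIn-fromℕ zero    = ≡.refl
punchIn-fromℕ (suc i) = ≡.cong suc (punchIn-fromℕ i)

punchIn-inject₁-≤ : ∀ {j k : Fin n} → j ≤ k → punchIn (inject₁ j) k ≡ suc k
punchIn-inject₁-≤ {j = zero}             _         = ≡.refl
punchIn-inject₁-≤ {j = suc j} {suc k} (s≤s j≤k) = ≡.cong suc (punchIn-inject₁-≤ j≤k)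

punchIn-suc-≤ : ∀ {j k : Fin n} → j ≤ k → punchIn (suc k) j ≡ inject₁ j
punchIn-suc-≤ {j = zero}             _         = ≡.refl
punchIn-suc-≤ {j = suc j} {suc k} (s≤s j≤k) = ≡.cong suc (punchIn-suc-≤ j≤k)

-- The cosimplicial identity for coface maps: removing two columns in either order leaves the same
-- columns, so the two double minors attached to a pair of columns coincide.
punchIn-comm : ∀ {j k : Fin (ℕ.suc n)} → j ≤ k → ∀ l →
               punchIn (inject₁ j) (punchIn k l) ≡ punchIn (suc k) (punchIn j l)
punchIn-comm {j = zero}          _         l       = ≡.refl
punchIn-comm {j = suc j} {suc k} (s≤s j≤k) zero    = ≡.refl
punchIn-comm {j = suc j} {suc k} (s≤s j≤k) (suc l) = ≡.cong suc (punchIn-comm j≤k l)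

module LinearAlgebra {c ℓ} (R : CommutativeRing c ℓ) where

  open CommutativeRing R hiding (zero)
  open Matrices R
  open RingProperties ring
  open CommutativeSemigroupProperties *-commutativeSemigroup using (x∙yz≈y∙xz)
  open Exp semiring using (_^_)
  open Sum semiring using (sum; sum-cong-≋; sum-replicate-zero; sum-init-last;
    ∑-distrib-+; ∑-comm; *-distribˡ-sum; *-distribʳ-sum)
  module ≈-Reasoning = SetoidReasoning setoid

  -- Sums

  0*≈0 : ∀ {x y} → x ≈ 0# → x * y ≈ 0#
  0*≈0 x≈0 = trans (*-congʳ x≈0) (zeroˡ _)

  *0≈0 : ∀ {x y} → y ≈ 0# → x * y ≈ 0#
  *0≈0 y≈0 = trans (*-congˡ y≈0) (zeroʳ _)

  1*≈ : ∀ {x y} → x ≈ 1# → x * y ≈ y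
  1*≈ x≈1 = trans (*-congʳ x≈1) (*-identityˡ _)

  *1≈ : ∀ {x y} → y ≈ 1# → x * y ≈ x
  *1≈ y≈1 = trans (*-congˡ y≈1) (*-identityʳ _)

  0+≈ : ∀ {x y} → x ≈ 0# → x + y ≈ y
  0+≈ x≈0 = trans (+-congʳ x≈0) (+-identityˡ _)

  +0≈ : ∀ {x y} → y ≈ 0# → x + y ≈ x
  +0≈ y≈0 = trans (+-congˡ y≈0) (+-identityʳ _)

  sum-zero : {f : Vector Carrier n} → (∀ i → f i ≈ 0#) → sum f ≈ 0#
  sum-zero {n} f≈0 = trans (sum-cong-≋ f≈0) (sum-replicate-zero n)

  sum-single : ∀ (f : Vector Carrier n) i → (∀ j → j ≢ i → f j ≈ 0#) → sum f ≈ f i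
  sum-single f zero f≈0 =
    +0≈ (sum-zero (λ j → f≈0 (suc j) λ ()))
  sum-single f (suc i) f≈0 =
    trans (+-cong (f≈0 zero λ ()) (sum-single (tail f) i λ j j≢i → f≈0 (suc j) (j≢i ∘ suc-injective)))
          (+-identityˡ _)

  sum-linear : ∀ (f g : Vector Carrier n) x →
               sum (λ j → f j + x * g j) ≈ sum f + x * sum g
  sum-linear f g x =
    trans (∑-distrib-+ f (λ j → x * g j)) (+-congˡ (sym (*-distribˡ-sum x g)))

  sum-neg : ∀ (f : Vector Carrier n) → sum (λ j → - f j) ≈ - sum f
  sum-neg {n} f = trans (sum-cong-≋ {n} λ j → sym (-1*x≈-x (f j)))
                    (trans (sym (*-distribˡ-sum (- 1#) f)) (-1*x≈-x (sum f)))

  -- Matrices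

  ≋-setoid : ℕ → Setoid c ℓ
  ≋-setoid n = record
    { Carrier       = Matrix n
    ; _≈_           = _≋_
    ; isEquivalence = record
      { refl  = λ i j → refl
      ; sym   = λ A≋B i j → sym (A≋B i j)
      ; trans = λ A≋B B≋C i j → trans (A≋B i j) (B≋C i j)
      }
    }

  module ≋ {n} = Setoid (≋-setoid n)
  module ≋-Reasoning {n} = SetoidReasoning (≋-setoid n)

  ·-cong : ∀ {A B C D : Matrix n} → A ≋ B → C ≋ D → A · C ≋ B · D
  ·-cong A≋B C≋D i j = sum-cong-≋ λ k → *-cong (A≋B i k) (C≋D k j)

  ·-congˡ : ∀ {A C D : Matrix n} → C ≋ D → A · C ≋ A · D
  ·-congˡ = ·-cong ≋.refl

  ·-congʳ : ∀ {A B C : Matrix n} → A ≋ B → A · C ≋ B · C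
  ·-congʳ A≋B = ·-cong A≋B ≋.refl

  ·-assoc : ∀ (A B C : Matrix n) → A · B · C ≋ A · (B · C)
  ·-assoc {n} A B C i j = let open ≈-Reasoning in begin
    sum (λ k → sum (λ l → A i l * B l k) * C k j)
      ≈⟨ sum-cong-≋ (λ k → *-distribʳ-sum (C k j) (λ l → A i l * B l k)) ⟩
    sum (λ k → sum (λ l → A i l * B l k * C k j))
      ≈⟨ ∑-comm (λ k l → A i l * B l k * C k j) ⟩
    sum (λ l → sum (λ k → A i l * B l k * C k j))
      ≈⟨ sum-cong-≋ (λ l → trans (sum-cong-≋ {n} λ k → *-assoc (A i l) (B l k) (C k j))
                                 (sym (*-distribˡ-sum (A i l) (λ k → B l k * C k j)))) ⟩
    sum (λ l → A i l * sum (λ k → B l k * C k j)) ∎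

  ·-init : ∀ (A B : Matrix (ℕ.suc n)) i j → A i (fromℕ n) * B (fromℕ n) j ≈ 0# →
           (A · B) i j ≈ sum λ k → A i (inject₁ k) * B (inject₁ k) j
  ·-init A B i j AB≈0 = trans (sum-init-last λ k → A i k * B k j) (+0≈ AB≈0)

  ·-last : ∀ (A B : Matrix (ℕ.suc n)) i j → (∀ k → A i (inject₁ k) * B (inject₁ k) j ≈ 0#) →
           (A · B) i j ≈ A i (fromℕ n) * B (fromℕ n) j
  ·-last A B i j AB≈0 = trans (sum-init-last λ k → A i k * B k j) (0+≈ (sum-zero AB≈0))

  diag-≡ : ∀ (d : Vector Carrier n) i → diag d i i ≈ d i
  diag-≡ d i = reflexive (if-yes (i ≟ i) ≡.refl)

  diag-≢ : ∀ (d : Vector Carrier n) {i j} → i ≢ j → diag d i j ≈ 0#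
  diag-≢ d {i} {j} i≢j = reflexive (if-no (i ≟ j) i≢j)

  diag-· : ∀ (d : Vector Carrier n) A i j → (diag d · A) i j ≈ d i * A i j
  diag-· d A i j = trans
    (sum-single (λ k → diag d i k * A k j) i λ k k≢i → 0*≈0 (diag-≢ d (k≢i ∘ ≡.sym)))
    (*-congʳ (diag-≡ d i))

  ·-diag : ∀ (d : Vector Carrier n) A i j → (A · diag d) i j ≈ A i j * d j
  ·-diag d A i j = trans
    (sum-single (λ k → A i k * diag d k j) j λ k k≢j → *0≈0 (diag-≢ d k≢j))
    (*-congˡ (diag-≡ d j))

  𝟙 : Matrix n
  𝟙 = diag λ _ → 1#

  ·-identityˡ : ∀ (A : Matrix n) → 𝟙 · A ≋ A
  ·-identityˡ A i j = trans (diag-· _ A i j) (*-identityˡ _)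

  ·-identityʳ : ∀ (A : Matrix n) → A · 𝟙 ≋ A
  ·-identityʳ A i j = trans (·-diag _ A i j) (*-identityʳ _)

  ·-cancel-inverseˡ : ∀ {A B : Matrix n} C → A · B ≋ 𝟙 → A · (B · C) ≋ C
  ·-cancel-inverseˡ C AB≋𝟙 =
    ≋.trans (≋.sym (·-assoc _ _ C)) (≋.trans (·-congʳ AB≋𝟙) (·-identityˡ C))

  ·-cancel-inverseʳ : ∀ {A B : Matrix n} C → A · B ≋ 𝟙 → C · A · B ≋ C
  ·-cancel-inverseʳ C AB≋𝟙 =
    ≋.trans (·-assoc C _ _) (≋.trans (·-congˡ AB≋𝟙) (·-identityʳ C))

  -- Unipotent matrices

  𝟙-unipotent : IsUpperUnipotent (𝟙 {n})
  𝟙-unipotent = diag-≡ _ , λ i j j<i → diag-≢ _ (Fin.<⇒≢ j<i ∘ ≡.sym)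

  tail-unipotent : ∀ {u : Matrix (ℕ.suc n)} → IsUpperUnipotent u →
                   IsUpperUnipotent (λ i j → u (suc i) (suc j))
  tail-unipotent (u≈1 , u≈0) = u≈1 ∘ suc , λ i j j<i → u≈0 (suc i) (suc j) (s<s j<i)

  init-unipotent : ∀ {u : Matrix (ℕ.suc n)} → IsUpperUnipotent u →
                   IsUpperUnipotent (λ i j → u (inject₁ i) (inject₁ j))
  init-unipotent (u≈1 , u≈0) = u≈1 ∘ inject₁ , λ i j j<i →
    u≈0 (inject₁ i) (inject₁ j)
        (≡.subst₂ ℕ._<_ (≡.sym (toℕ-inject₁ j)) (≡.sym (toℕ-inject₁ i)) j<i)

  unipotent-· : ∀ {u v : Matrix n} → IsUpperUnipotent u → IsUpperUnipotent v →
                IsUpperUnipotent (u · v)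
  unipotent-· {u = u} {v} (u≈1 , u≈0) (v≈1 , v≈0) = uv≈1 , uv≈0
    where
    uv≈1 : ∀ i → (u · v) i i ≈ 1#
    uv≈1 i = let open ≈-Reasoning in begin
      sum (λ k → u i k * v k i) ≈⟨ sum-single (λ k → u i k * v k i) i off ⟩
      u i i * v i i             ≈⟨ *-cong (u≈1 i) (v≈1 i) ⟩
      1# * 1#                   ≈⟨ *-identityˡ 1# ⟩
      1#                        ∎
      where
      off : ∀ k → k ≢ i → u i k * v k i ≈ 0#
      off k k≢i with Fin.<-cmp k i
      ... | tri< k<i _ _ = 0*≈0 (u≈0 i k k<i)
      ... | tri≈ _ k≡i _ = contradiction k≡i k≢i
      ... | tri> _ _ i<k = *0≈0 (v≈0 k i i<k)
    uv≈0 : ∀ i j → j < i → (u · v) i j ≈ 0#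
    uv≈0 i j j<i = sum-zero off
      where
      off : ∀ k → u i k * v k j ≈ 0#
      off k with k Fin.<? i
      ... | yes k<i = 0*≈0 (u≈0 i k k<i)
      ... | no  k≮i = *0≈0 (v≈0 k j (ℕ.<-≤-trans j<i (ℕ.≮⇒≥ k≮i)))

  extendˡ : Vector Carrier n → Matrix n → Matrix (ℕ.suc n)
  extendˡ a A = (1# ∷ a) ∷ λ i → 0# ∷ A i

  extendˡ-unipotent : ∀ a {u : Matrix n} → IsUpperUnipotent u → IsUpperUnipotent (extendˡ a u)
  extendˡ-unipotent {n} a {u} (u≈1 , u≈0) = eu≈1 , eu≈0
    where
    eu≈1 : ∀ i → extendˡ a u i i ≈ 1#
    eu≈1 zero    = refl
    eu≈1 (suc i) = u≈1 i
    eu≈0 : ∀ i j → j < i → extendˡ a u i j ≈ 0#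
    eu≈0 (suc i) zero    _         = refl
    eu≈0 (suc i) (suc j) (s<s j<i) = u≈0 i j j<i

  -- Block inversion: if `v` is a right inverse of the lower right block of u = (1 a; 0 u′), then (1
  -- -av; 0 v) is one of `u`.
  unipotent-rightInverse : ∀ {u : Matrix n} → IsUpperUnipotent u →
                           ∃[ v ] IsUpperUnipotent v × u · v ≋ 𝟙
  unipotent-rightInverse {ℕ.zero}  _ = 𝟙 , 𝟙-unipotent , λ ()
  unipotent-rightInverse {ℕ.suc n} {u} u-uni@(u≈1 , u≈0)
    with unipotent-rightInverse (tail-unipotent u-uni)
  ... | v , v-uni , u′v≋𝟙 = extendˡ (λ j → - x j) v , extendˡ-unipotent _ v-uni , uv≋𝟙
    where
    x : Vector Carrier n
    x j = sum λ k → u zero (suc k) * v k j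
    uv≋𝟙 : u · extendˡ (λ j → - x j) v ≋ 𝟙
    uv≋𝟙 zero zero =
      trans (+-cong (*1≈ refl) (sum-zero {n} λ k → zeroʳ _)) (trans (+-identityʳ _) (u≈1 zero))
    uv≋𝟙 zero (suc j) = trans (+-congʳ (1*≈ (u≈1 zero))) (-‿inverseˡ (x j))
    uv≋𝟙 (suc i) zero = trans
      (+-cong (0*≈0 (u≈0 (suc i) zero z<s)) (sum-zero {n} λ k → zeroʳ _)) (+-identityʳ 0#)
    uv≋𝟙 (suc i) (suc j) = trans
      (0+≈ (0*≈0 (u≈0 (suc i) zero z<s))) (trans (u′v≋𝟙 i j) (reflexive (𝟙-suc i j)))
      where
      𝟙-suc : ∀ (i j : Fin n) → 𝟙 i j ≡ 𝟙 (suc i) (suc j)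
      𝟙-suc i j with i ≟ j
      ... | yes _ = ≡.refl
      ... | no  _ = ≡.refl

  -- The right inverse `v` has a right inverse `w` in turn, and u = u(vw) = (uv)w = w makes `v`
  -- two-sided.
  unipotent-inverse : ∀ {u : Matrix n} → IsUpperUnipotent u →
                      ∃[ v ] IsUpperUnipotent v × u · v ≋ 𝟙 × v · u ≋ 𝟙
  unipotent-inverse {u = u} u-uni with unipotent-rightInverse u-uni
  ... | v , v-uni , uv≋𝟙 with unipotent-rightInverse v-uni
  ... | w , _ , vw≋𝟙 = v , v-uni , uv≋𝟙 , ≋.trans (·-congˡ u≋w) vw≋𝟙
    where
    u≋w : u ≋ w
    u≋w = ≋.trans (≋.sym (·-cancel-inverseʳ u vw≋𝟙))
                  (≋.trans (·-congʳ uv≋𝟙) (·-identityˡ w))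

  -- Only the inner indices i and i+1 contribute to entry (i, i+1) of the product; triangularity
  -- kills the others. This is what makes `ψ` multiplicative.
  unipotent-superdiagonal : ∀ {u v : Matrix (ℕ.suc n)} → IsUpperUnipotent u → IsUpperUnipotent v →
    ∀ i → (u · v) (inject₁ i) (suc i) ≈ u (inject₁ i) (suc i) + v (inject₁ i) (suc i)
  unipotent-superdiagonal {ℕ.suc n} {u} {v} (u≈1 , u≈0) (v≈1 , v≈0) zero = let open ≈-Reasoning in begin
    u zero zero * v zero (suc zero) + (u zero (suc zero) * v (suc zero) (suc zero) + rest)
      ≈⟨ +-cong (1*≈ (u≈1 zero))
                (+-cong (*1≈ (v≈1 (suc zero)))
                        (sum-zero λ k → *0≈0 (v≈0 (suc (suc k)) (suc zero) (s<s z<s)))) ⟩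
    v zero (suc zero) + (u zero (suc zero) + 0#)
      ≈⟨ trans (+-congˡ (+-identityʳ _)) (+-comm _ _) ⟩
    u zero (suc zero) + v zero (suc zero) ∎
    where rest = sum λ k → u zero (suc (suc k)) * v (suc (suc k)) (suc zero)
  unipotent-superdiagonal {ℕ.suc n} u-uni@(_ , u≈0) v-uni (suc i) = trans
    (0+≈ (0*≈0 (u≈0 (suc (inject₁ i)) zero z<s)))
    (unipotent-superdiagonal (tail-unipotent u-uni) (tail-unipotent v-uni) i)

  infix 4 _≃_

  -- For the integral matrices of two cells this unfolds to `_∼_`, so facts about it serve directly
  -- as facts about double cosets.
  _≃_ : Matrix n → Matrix n → Set _
  A ≃ B = ∃[ u ] ∃[ v ] IsUpperUnipotent u × IsUpperUnipotent v × B ≋ u · A · v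

  ≋⇒≃ : ∀ {A B : Matrix n} → A ≋ B → A ≃ B
  ≋⇒≃ {A = A} A≋B = 𝟙 , 𝟙 , 𝟙-unipotent , 𝟙-unipotent ,
    ≋.trans (≋.sym A≋B) (≋.sym (≋.trans (·-identityʳ (𝟙 · A)) (·-identityˡ A)))

  ≃-trans : ∀ {A B C : Matrix n} → A ≃ B → B ≃ C → A ≃ C
  ≃-trans {A = A} {B} {C} (u , v , u-uni , v-uni , B≋uAv) (u′ , v′ , u′-uni , v′-uni , C≋u′Bv′) =
    u′ · u , v · v′ , unipotent-· u′-uni u-uni , unipotent-· v-uni v′-uni ,
    (let open ≋-Reasoning in begin
      C                     ≈⟨ C≋u′Bv′ ⟩
      u′ · B · v′           ≈⟨ ·-congʳ (·-congˡ (≋.trans B≋uAv (·-assoc u A v))) ⟩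
      u′ · (u · (A · v)) · v′ ≈⟨ ·-congʳ (·-assoc u′ u (A · v)) ⟨
      u′ · u · (A · v) · v′ ≈⟨ ·-congʳ (·-assoc (u′ · u) A v) ⟨
      u′ · u · A · v · v′   ≈⟨ ·-assoc (u′ · u · A) v v′ ⟩
      u′ · u · A · (v · v′) ∎)

  -- Determinants

  sign : Fin n → Carrier
  sign j = (- 1#) ^ toℕ j

  minor : Matrix (ℕ.suc n) → Fin (ℕ.suc n) → Matrix n
  minor A j k l = A (suc k) (punchIn j l)

  laplaceTerm : Matrix (ℕ.suc n) → Fin (ℕ.suc n) → Carrier
  laplaceTerm A j = sign j * (A zero j * det (minor A j))

  det-cong : ∀ {A B : Matrix n} → A ≋ B → det A ≈ det B
  det-cong {ℕ.zero}  A≋B = refl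
  det-cong {ℕ.suc n} A≋B = sum-cong-≋ λ j →
    *-congˡ {sign j} (*-cong (A≋B zero j) (det-cong λ k l → A≋B (suc k) (punchIn j l)))

  -- Three matrices that agree off row `i`, rather than updates of a single one, because these
  -- hypotheses pass as they stand to the minors of the first-row expansion.
  det-linear : ∀ i x (A B C : Matrix n) →
               (∀ k → k ≢ i → ∀ j → A k j ≈ B k j) →
               (∀ k → k ≢ i → ∀ j → A k j ≈ C k j) →
               (∀ j → A i j ≈ B i j + x * C i j) →
               det A ≈ det B + x * det C
  det-linear zero x A B C A≈B A≈C Aᵢ≈ =
    trans (sum-cong-≋ term) (sum-linear (laplaceTerm B) (laplaceTerm C) x)
    where
    term : ∀ j → laplaceTerm A j ≈ laplaceTerm B j + x * laplaceTerm C j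
    term j = let open ≈-Reasoning in begin
      s * (A zero j * det (minor A j))
        ≈⟨ *-congˡ (*-congʳ (Aᵢ≈ j)) ⟩
      s * ((B zero j + x * C zero j) * det (minor A j))
        ≈⟨ *-congˡ (trans (distribʳ _ _ _) (+-cong
             (*-congˡ (det-cong λ k l → A≈B (suc k) (λ ()) (punchIn j l)))
             (trans (*-assoc _ _ _)
                    (*-congˡ (*-congˡ (det-cong λ k l → A≈C (suc k) (λ ()) (punchIn j l))))))) ⟩
      s * (b + x * c′)
        ≈⟨ trans (distribˡ _ _ _) (+-congˡ (x∙yz≈y∙xz s x c′)) ⟩
      s * b + x * (s * c′) ∎
      where
      s = sign j
      b = B zero j * det (minor B j)
      c′ = C zero j * det (minor C j)
  det-linear (suc i) x A B C A≈B A≈C Aᵢ≈ =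
    trans (sum-cong-≋ term) (sum-linear (laplaceTerm B) (laplaceTerm C) x)
    where
    term : ∀ j → laplaceTerm A j ≈ laplaceTerm B j + x * laplaceTerm C j
    term j = let open ≈-Reasoning in begin
      s * (A zero j * det (minor A j))
        ≈⟨ *-congˡ (*-congˡ (det-linear i x _ _ _
             (λ k k≢i l → A≈B (suc k) (k≢i ∘ suc-injective) (punchIn j l))
             (λ k k≢i l → A≈C (suc k) (k≢i ∘ suc-injective) (punchIn j l))
             (λ l → Aᵢ≈ (punchIn j l)))) ⟩
      s * (A zero j * (b + x * c′))
        ≈⟨ *-congˡ (trans (distribˡ _ _ _) (+-cong
             (*-congʳ (A≈B zero (λ ()) j))
             (trans (x∙yz≈y∙xz _ _ _) (*-congˡ (*-congʳ (A≈C zero (λ ()) j)))))) ⟩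
      s * (B zero j * b + x * (C zero j * c′))
        ≈⟨ trans (distribˡ _ _ _) (+-congˡ (x∙yz≈y∙xz s x _)) ⟩
      s * (B zero j * b) + x * (s * (C zero j * c′)) ∎
      where
      s = sign j
      b = det (minor B j)
      c′ = det (minor C j)

  infixl 8 _[_≔_]

  _[_≔_] : ∀ {m} → Vector (Vector Carrier n) m → Fin m → Vector Carrier n → Vector (Vector Carrier n) m
  A [ i ≔ v ] = updateAt A i (const v)

  [≔]-updates : ∀ {m} (A : Vector (Vector Carrier n) m) i v j → (A [ i ≔ v ]) i j ≈ v j
  [≔]-updates A i v j = reflexive (≡.cong-app (updateAt-updates i A) j)

  [≔]-minimal : ∀ {m} (A : Vector (Vector Carrier n) m) {i k} v → k ≢ i →
                ∀ j → (A [ i ≔ v ]) k j ≈ A k j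
  [≔]-minimal A {i} {k} v k≢i j = reflexive (≡.cong-app (updateAt-minimal k i A k≢i) j)

  record IsLinear (h : Vector Carrier n → Carrier) : Set (c ⊔ ℓ) where
    field
      cong   : ∀ {u v} → (∀ j → u j ≈ v j) → h u ≈ h v
      linear : ∀ u v x → h (λ j → u j + x * v j) ≈ h u + x * h v

    -- The single law `linear`, at scalar -1 and zero vectors, gives h 0 = h 0 - h 0.
    zero-homo : h (λ _ → 0#) ≈ 0#
    zero-homo = let open ≈-Reasoning in begin
      h (λ _ → 0#)                             ≈⟨ cong (λ j → sym (-‿inverseʳ′ 0#)) ⟩
      h (λ _ → 0# + - 1# * 0#)                 ≈⟨ linear _ _ (- 1#) ⟩
      h (λ _ → 0#) + - 1# * h (λ _ → 0#)       ≈⟨ -‿inverseʳ′ _ ⟩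
      0#                                       ∎
      where
      -‿inverseʳ′ : ∀ x → x + - 1# * x ≈ 0#
      -‿inverseʳ′ x = trans (+-congˡ (-1*x≈-x x)) (-‿inverseʳ x)

    -- The vector `u` is an accumulator: each step of the induction absorbs one term into it. It
    -- also covers both uses, a row plus multiples of other rows and a bare combination over the
    -- zero row.
    sum-homo : ∀ {m} u (a : Vector Carrier m) (w : Fin m → Vector Carrier n) →
               h (λ j → u j + sum λ l → a l * w l j) ≈ h u + sum λ l → a l * h (w l)
    sum-homo {ℕ.zero}  u a w = trans (cong λ j → +-identityʳ _) (sym (+-identityʳ _))
    sum-homo {ℕ.suc m} u a w = let open ≈-Reasoning in begin
      h (λ j → u j + (a zero * w zero j + sum λ l → a (suc l) * w (suc l) j))
        ≈⟨ cong (λ j → +-assoc _ _ _) ⟨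
      h (λ j → (u j + a zero * w zero j) + sum λ l → a (suc l) * w (suc l) j)
        ≈⟨ sum-homo _ (tail a) (tail w) ⟩
      h (λ j → u j + a zero * w zero j) + sum (λ l → a (suc l) * h (w (suc l)))
        ≈⟨ trans (+-congʳ (linear u (w zero) (a zero))) (+-assoc _ _ _) ⟩
      h u + (a zero * h (w zero) + sum λ l → a (suc l) * h (w (suc l))) ∎

  det-row-linear : ∀ (A : Matrix n) i → IsLinear (λ v → det (A [ i ≔ v ]))
  det-row-linear A i = record
    { cong   = λ {u} {v} u≈v → det-cong λ k j → congᵣ u≈v k j
    ; linear = λ u v x → det-linear i x _ _ _
        (λ k k≢i j → trans ([≔]-minimal A _ k≢i j) (sym ([≔]-minimal A _ k≢i j)))
        (λ k k≢i j → trans ([≔]-minimal A _ k≢i j) (sym ([≔]-minimal A _ k≢i j)))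
        (λ j → trans ([≔]-updates A i _ j)
                     (sym (+-cong ([≔]-updates A i u j) (*-congˡ ([≔]-updates A i v j)))))
    }
    where
    congᵣ : ∀ {u v} → (∀ j → u j ≈ v j) → A [ i ≔ u ] ≋ A [ i ≔ v ]
    congᵣ u≈v k j with k ≟ i
    ... | yes ≡.refl = trans ([≔]-updates A i _ j) (trans (u≈v j) (sym ([≔]-updates A i _ j)))
    ... | no k≢i     = trans ([≔]-minimal A _ k≢i j) (sym ([≔]-minimal A _ k≢i j))

  -- Polarisation of the alternating form: 0 = h(a+b,a+b) = h(a,b) + h(b,a).
  det-swap : ∀ {p q : Fin n} → p ≢ q →
             (∀ A → (∀ j → A p j ≈ A q j) → det A ≈ 0#) →
             ∀ A B → (∀ k → k ≢ p → k ≢ q → ∀ j → A k j ≈ B k j) →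
             (∀ j → A p j ≈ B q j) → (∀ j → A q j ≈ B p j) →
             det A ≈ - det B
  det-swap {n} {p} {q} p≢q alternating A B A≈B Aₚ≈ A_q≈ = let open ≈-Reasoning in begin
    det A           ≈⟨ det-cong A≋M ⟩
    h (A p) (A q)   ≈⟨ huv≈-hvu ⟩
    - h (A q) (A p) ≈⟨ -‿cong (det-cong B≋M) ⟨
    - det B         ∎
    where
    M : Vector Carrier n → Vector Carrier n → Matrix n
    M u v = A [ p ≔ u ] [ q ≔ v ]
    h : Vector Carrier n → Vector Carrier n → Carrier
    h u v = det (M u v)
    M-p : ∀ u v j → M u v p j ≈ u j
    M-p u v j = trans ([≔]-minimal _ v p≢q j) ([≔]-updates A p u j)
    M-q : ∀ u v j → M u v q j ≈ v j
    M-q u v = [≔]-updates _ q v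
    M-other : ∀ u v k → k ≢ p → k ≢ q → ∀ j → M u v k j ≈ A k j
    M-other u v k k≢p k≢q j = trans ([≔]-minimal _ v k≢q j) ([≔]-minimal A u k≢p j)
    by-rows : ∀ {X Y : Matrix n} → (∀ k → k ≢ p → k ≢ q → ∀ j → X k j ≈ Y k j) →
              (∀ j → X p j ≈ Y p j) → (∀ j → X q j ≈ Y q j) → X ≋ Y
    by-rows other at-p at-q k j with k ≟ p | k ≟ q
    ... | yes ≡.refl | _          = at-p j
    ... | no _       | yes ≡.refl = at-q j
    ... | no k≢p     | no k≢q     = other k k≢p k≢q j
    A≋M : A ≋ M (A p) (A q)
    A≋M = by-rows (λ k k≢p k≢q j → sym (M-other _ _ k k≢p k≢q j))
                  (λ j → sym (M-p _ _ j)) (λ j → sym (M-q _ _ j))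
    B≋M : B ≋ M (A q) (A p)
    B≋M = by-rows (λ k k≢p k≢q j → trans (sym (A≈B k k≢p k≢q j)) (sym (M-other _ _ k k≢p k≢q j)))
                  (λ j → trans (sym (A_q≈ j)) (sym (M-p _ _ j)))
                  (λ j → trans (sym (Aₚ≈ j)) (sym (M-q _ _ j)))
    h-diagonal : ∀ u → h u u ≈ 0#
    h-diagonal u = alternating _ λ j → trans (M-p u u j) (sym (M-q u u j))
    _⊞_ : Vector Carrier n → Vector Carrier n → Vector Carrier n
    (u ⊞ v) j = u j + 1# * v j
    h-⊞ʳ : ∀ u v w → h u (v ⊞ w) ≈ h u v + h u w
    h-⊞ʳ u v w = trans (IsLinear.linear (det-row-linear (A [ p ≔ u ]) q) v w 1#)
                       (+-congˡ (*-identityˡ _))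
    h-⊞ˡ : ∀ u v w → h (u ⊞ v) w ≈ h u w + h v w
    h-⊞ˡ u v w = trans
      (det-linear p 1# _ _ _ (agree u) (agree v)
        (λ j → trans (M-p _ w j) (sym (+-cong (M-p u w j) (*-congˡ (M-p v w j))))))
      (+-congˡ (*-identityˡ _))
      where
      agree : ∀ u′ k → k ≢ p → ∀ j → M (u ⊞ v) w k j ≈ M u′ w k j
      agree u′ k k≢p j with k ≟ q
      ... | yes ≡.refl = trans (M-q _ w j) (sym (M-q u′ w j))
      ... | no k≢q     = trans (M-other _ w k k≢p k≢q j) (sym (M-other u′ w k k≢p k≢q j))
    huv≈-hvu : h (A p) (A q) ≈ - h (A q) (A p)
    huv≈-hvu = +-inverseˡ-unique _ _ (begin
      h u v + h v u                     ≈⟨ +-cong (0+≈ (h-diagonal u)) (+0≈ (h-diagonal v)) ⟨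
      (h u u + h u v) + (h v u + h v v) ≈⟨ +-cong (h-⊞ʳ u u v) (h-⊞ʳ v u v) ⟨
      h u (u ⊞ v) + h v (u ⊞ v)         ≈⟨ h-⊞ˡ u v (u ⊞ v) ⟨
      h (u ⊞ v) (u ⊞ v)                 ≈⟨ h-diagonal (u ⊞ v) ⟩
      0#                                ∎)
      where
      open ≈-Reasoning
      u = A p
      v = A q

  -- (j, k) stands for the ordered pair (j, punchIn j k) of distinct indices; for
  -- j ≤ k, the pairs (inject₁ j, k) and (suc k, j) are transposes of each other.
  sum-antisymmetric : ∀ (H : Fin (ℕ.suc n) → Fin n → Carrier) →
    (∀ j k → j ≤ k → H (inject₁ j) k + H (suc k) j ≈ 0#) → sum (λ j → sum (H j)) ≈ 0#
  sum-antisymmetric {ℕ.zero}  H _    = +0≈ refl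
  sum-antisymmetric {ℕ.suc n} H pair = let open ≈-Reasoning in begin
    sum (H zero) + sum (λ k → H (suc k) zero + sum (λ l → H (suc k) (suc l)))
      ≈⟨ +-congˡ (∑-distrib-+ (λ k → H (suc k) zero) (λ k → sum (λ l → H (suc k) (suc l)))) ⟩
    sum (H zero) + (sum (λ k → H (suc k) zero) + sum (λ k → sum (λ l → H (suc k) (suc l))))
      ≈⟨ +-assoc _ _ _ ⟨
    sum (H zero) + sum (λ k → H (suc k) zero) + sum (λ k → sum (λ l → H (suc k) (suc l)))
      ≈⟨ +-cong (trans (sym (∑-distrib-+ (H zero) (λ k → H (suc k) zero)))
                       (sum-zero λ k → pair zero k z≤n))
                (sum-antisymmetric (λ k l → H (suc k) (suc l))
                  (λ j k j≤k → pair (suc j) (suc k) (s≤s j≤k))) ⟩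
    0# + 0#
      ≈⟨ +-identityˡ 0# ⟩
    0# ∎

  -- Expansion along two rows gives a sum over ordered pairs of distinct columns. A pair and its
  -- transpose share their double minor and, the two rows being equal, their entries. Their signs
  -- are opposite: removing the smaller column first lowers the index of the larger one by one.
  det-alternating₀₁ : ∀ (A : Matrix (ℕ.suc (ℕ.suc n))) → (∀ j → A zero j ≈ A (suc zero) j) → det A ≈ 0#
  det-alternating₀₁ A A₀≈A₁ = trans (sum-cong-≋ expand) (sum-antisymmetric H pair)
    where
    d : Fin _ → Fin _ → Carrier
    d j k = det λ i l → A (suc (suc i)) (punchIn j (punchIn k l))
    H : Fin _ → Fin _ → Carrier
    H j k = sign j * (A zero j * (sign k * (A (suc zero) (punchIn j k) * d j k)))
    inner : Fin _ → Fin _ → Carrier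
    inner j k = sign k * (A (suc zero) (punchIn j k) * d j k)
    expand : ∀ j → sign j * (A zero j * sum (inner j)) ≈ sum (H j)
    expand j = trans (*-congˡ (*-distribˡ-sum (A zero j) (inner j)))
                     (*-distribˡ-sum (sign j) (λ k → A zero j * inner j k))
    rearrange : ∀ s t x y z → s * (x * (t * (y * z))) ≈ t * (y * (s * (x * z)))
    rearrange s t x y z = let open ≈-Reasoning in begin
      s * (x * (t * (y * z))) ≈⟨ *-congˡ (x∙yz≈y∙xz x t _) ⟩
      s * (t * (x * (y * z))) ≈⟨ x∙yz≈y∙xz s t _ ⟩
      t * (s * (x * (y * z))) ≈⟨ *-congˡ (*-congˡ (x∙yz≈y∙xz x y z)) ⟩
      t * (s * (y * (x * z))) ≈⟨ *-congˡ (x∙yz≈y∙xz s y _) ⟩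
      t * (y * (s * (x * z))) ∎
    pair : ∀ j k → j ≤ k → H (inject₁ j) k + H (suc k) j ≈ 0#
    pair j k j≤k = let open ≈-Reasoning in begin
      H (inject₁ j) k + H (suc k) j
        ≈⟨ +-cong
             (*-cong (reflexive (≡.cong ((- 1#) ^_) (toℕ-inject₁ j)))
                     (*-cong (A₀≈A₁ _) (*-congˡ (*-congʳ
                       (trans (reflexive (≡.cong (A (suc zero)) (punchIn-inject₁-≤ j≤k)))
                              (sym (A₀≈A₁ _)))))))
             (*-congˡ (*-congˡ (*-congˡ (*-cong
                (reflexive (≡.cong (A (suc zero)) (punchIn-suc-≤ j≤k)))
                (det-cong λ i l → reflexive
                  (≡.cong (A (suc (suc i))) (≡.sym (punchIn-comm j≤k l)))))))) ⟩
      sign j * (y * (sign k * (x * z))) + - 1# * sign k * (x * (sign j * (y * z)))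
        ≈⟨ +-cong (rearrange (sign j) (sign k) y x z)
                  (trans (*-assoc _ _ _) (-1*x≈-x _)) ⟩
      sign k * (x * (sign j * (y * z))) + - (sign k * (x * (sign j * (y * z))))
        ≈⟨ -‿inverseʳ _ ⟩
      0# ∎
      where
      x = A zero (suc k)
      y = A (suc zero) (inject₁ j)
      z = d (inject₁ j) k

  private
    Alternating : ℕ → Set _
    Alternating n = ∀ (A : Matrix n) p q → p ≢ q → (∀ j → A p j ≈ A q j) → det A ≈ 0#

  -- `B` exchanges the second row of `A` with the row equal to the first, so that its first two rows
  -- agree. The first row stays in place, hence the exchange takes place inside the minors, where
  -- the alternating property of the smaller size turns it into a sign.
  det-alternating₀ : Alternating n → ∀ (A : Matrix (ℕ.suc n)) q →
                     (∀ j → A zero j ≈ A (suc q) j) → det A ≈ 0#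
  det-alternating₀ _ A zero A₀≈A₁ = det-alternating₀₁ A A₀≈A₁
  det-alternating₀ {ℕ.suc n} alternating A (suc q) A₀≈A_q = let open ≈-Reasoning in begin
    det A                         ≈⟨ sum-cong-≋ minors ⟩
    sum (λ j → - laplaceTerm B j) ≈⟨ sum-neg (laplaceTerm B) ⟩
    - det B                       ≈⟨ -‿cong (det-alternating₀₁ B A₀≈A_q) ⟩
    - 0#                          ≈⟨ -0#≈0# ⟩
    0#                            ∎
    where
    B : Matrix _
    B = A zero ∷ A (suc (suc q)) ∷ tail (tail A [ suc q ≔ A (suc zero) ])
    minors : ∀ j → laplaceTerm A j ≈ - laplaceTerm B j
    minors j = trans
      (*-congˡ (trans (*-congˡ (det-swap {p = zero} {q = suc q} (λ ())
        (λ X → alternating X zero (suc q) (λ ()))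
        (minor A j) (minor B j)
        (λ { zero 0≢0 _ l → contradiction ≡.refl 0≢0
           ; (suc k) _ k≢q l → sym ([≔]-minimal (tail A) (A (suc zero)) k≢q (punchIn j l)) })
        (λ l → sym ([≔]-updates (tail A) (suc q) (A (suc zero)) (punchIn j l)))
        (λ l → refl)))
        (sym (-‿distribʳ-* _ _))))
      (sym (-‿distribʳ-* _ _))

  det-alternating : ∀ (A : Matrix n) p q → p ≢ q → (∀ j → A p j ≈ A q j) → det A ≈ 0#
  det-alternating {ℕ.suc n} A zero    zero    p≢q _ = contradiction ≡.refl p≢q
  det-alternating {ℕ.suc n} A zero    (suc q) _ Aₚ≈A_q =
    det-alternating₀ det-alternating A q Aₚ≈A_q
  det-alternating {ℕ.suc n} A (suc p) zero    _ Aₚ≈A_q =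
    det-alternating₀ det-alternating A p (sym ∘ Aₚ≈A_q)
  det-alternating {ℕ.suc n} A (suc p) (suc q) p≢q Aₚ≈A_q = sum-zero λ j →
    *0≈0 {sign j} (*0≈0 {A zero j} (det-alternating (minor A j) p q
                  (p≢q ∘ ≡.cong suc) (Aₚ≈A_q ∘ punchIn j)))

  -- The minors along the first row of u·X are those of `X` multiplied by the lower right block of
  -- `u`, so by induction only the first row changes. It gains a combination of the other rows of
  -- `X`, which contributes nothing by alternation.
  det-unipotentˡ : ∀ {u : Matrix n} → IsUpperUnipotent u → ∀ X → det (u · X) ≈ det X
  det-unipotentˡ {ℕ.zero}  _ X = refl
  det-unipotentˡ {ℕ.suc n} {u} u-uni@(u≈1 , u≈0) X = let open ≈-Reasoning in begin
    det (u · X)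
      ≈⟨ sum-cong-≋ (λ j → *-congˡ {sign j} (*-cong (row₀ j) (minors j))) ⟩
    det (X [ zero ≔ (λ j → X zero j + sum λ l → u zero (suc l) * X (suc l) j) ])
      ≈⟨ sum-homo (X zero) (λ l → u zero (suc l)) (tail X) ⟩
    det (X [ zero ≔ X zero ]) + sum (λ l → u zero (suc l) * det (X [ zero ≔ X (suc l) ]))
      ≈⟨ +0≈ (sum-zero {n} λ l → *0≈0 (det-alternating (X [ zero ≔ X (suc l) ])
                                         zero (suc l) (λ ()) λ j → refl)) ⟩
    det (X [ zero ≔ X zero ])
      ≈⟨ det-cong {A = X [ zero ≔ X zero ]} {X} (λ { zero j → refl ; (suc i) j → refl }) ⟩
    det X ∎
    where
    open IsLinear (det-row-linear X zero)
    row₀ : ∀ j → (u · X) zero j ≈ X zero j + sum λ l → u zero (suc l) * X (suc l) j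
    row₀ j = +-congʳ (1*≈ (u≈1 zero))
    minors : ∀ j → det (minor (u · X) j) ≈ det (minor X j)
    minors j = trans
      (det-cong λ k l → 0+≈ (0*≈0 (u≈0 (suc k) zero z<s)))
      (det-unipotentˡ (tail-unipotent u-uni) (minor X j))

  -- The cofactor at (i, k), placed at (k, i), written with row `i` replaced by a basis vector so
  -- that linearity in that row applies.
  adjugate : Matrix n → Matrix n
  adjugate A k i = det (A [ i ≔ 𝟙 k ])

  -- Row `m` of `A` is the combination of basis vectors with coefficients A m k, so linearity
  -- collapses the sum to the determinant of `A` with row `i` replaced by row `m`. Off the diagonal
  -- that matrix has two equal rows.
  ·-adjugate : ∀ (A : Matrix n) → A · adjugate A ≋ diag λ _ → det A
  ·-adjugate A m i = let open ≈-Reasoning in begin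
    sum (λ k → A m k * det (A [ i ≔ 𝟙 k ]))
      ≈⟨ 0+≈ zero-homo ⟨
    det (A [ i ≔ (λ _ → 0#) ]) + sum (λ k → A m k * det (A [ i ≔ 𝟙 k ]))
      ≈⟨ sum-homo (λ _ → 0#) (A m) 𝟙 ⟨
    det (A [ i ≔ (λ j → 0# + (A · 𝟙) m j) ])
      ≈⟨ cong (λ j → trans (+-identityˡ _) (·-identityʳ A m j)) ⟩
    det (A [ i ≔ A m ])
      ≈⟨ replaced ⟩
    diag (λ _ → det A) m i ∎
    where
    open IsLinear (det-row-linear A i)
    replaced : det (A [ i ≔ A m ]) ≈ diag (λ _ → det A) m i
    replaced with m ≟ i
    ... | no m≢i = det-alternating _ m i m≢i λ j →
      trans ([≔]-minimal A (A m) m≢i j) (sym ([≔]-updates A i (A m) j))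
    ... | yes ≡.refl = det-cong unchanged
      where
      unchanged : A [ i ≔ A i ] ≋ A
      unchanged k j with k ≟ i
      ... | yes ≡.refl = [≔]-updates A i (A i) j
      ... | no k≢i     = [≔]-minimal A (A i) k≢i j

  sign² : ∀ k → (- 1#) ^ k * (- 1#) ^ k ≈ 1#
  sign² ℕ.zero    = *-identityˡ 1#
  sign² (ℕ.suc k) = let open ≈-Reasoning in begin
    - 1# * s * (- 1# * s) ≈⟨ *-cong (-1*x≈-x s) (-1*x≈-x s) ⟩
    - s * - s             ≈⟨ trans (sym (-‿distribˡ-* s (- s))) (-‿cong (sym (-‿distribʳ-* s s))) ⟩
    - - (s * s)           ≈⟨ -‿involutive (s * s) ⟩
    s * s                 ≈⟨ sign² k ⟩
    1#                    ∎
    where s = (- 1#) ^ k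

  -- Blocks

  lowerLeft : Matrix (ℕ.suc n) → Matrix n
  lowerLeft A i j = A (suc i) (inject₁ j)

  lowerRight : Matrix (ℕ.suc n) → Matrix n
  lowerRight A i j = A (suc i) (suc j)

  upperLeft : Matrix (ℕ.suc n) → Matrix n
  upperLeft A i j = A (inject₁ i) (inject₁ j)

  lowerLeft-cong : ∀ {A B : Matrix (ℕ.suc n)} → A ≋ B → lowerLeft A ≋ lowerLeft B
  lowerLeft-cong A≋B i j = A≋B (suc i) (inject₁ j)

  lowerLeft-·ʳ : ∀ (X : Matrix (ℕ.suc n)) {v} → IsUpperUnipotent v →
                 lowerLeft (X · v) ≋ lowerLeft X · upperLeft v
  lowerLeft-·ʳ X {v} (_ , v≈0) i j =
    ·-init X v (suc i) (inject₁ j) (*0≈0 (v≈0 (fromℕ _) (inject₁ j) (inject₁<fromℕ j)))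

  lowerLeft-· : ∀ {u} (X : Matrix (ℕ.suc n)) {v} → IsUpperUnipotent u → IsUpperUnipotent v →
                lowerLeft (u · X · v) ≋ lowerRight u · lowerLeft X · upperLeft v
  lowerLeft-· {u = u} X {v} (_ , u≈0) v-uni = ≋.trans
    (lowerLeft-·ʳ (u · X) v-uni)
    (·-congʳ λ i j → 0+≈ (0*≈0 (u≈0 (suc i) zero z<s)))

  det-row₀-last : ∀ (A : Matrix (ℕ.suc n)) → (∀ j → A zero (inject₁ j) ≈ 0#) →
                  det A ≈ (- 1#) ^ n * (A zero (fromℕ n) * det (lowerLeft A))
  det-row₀-last {n} A A₀≈0 = trans
    (sum-single (laplaceTerm A) (fromℕ n) (∀-last (λ j _ → *0≈0 (0*≈0 (A₀≈0 j)))
      λ n≢n → contradiction ≡.refl n≢n))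
    (*-cong (reflexive (≡.cong ((- 1#) ^_) (toℕ-fromℕ n)))
            (*-congˡ (det-cong λ k l → reflexive (≡.cong (A (suc k)) (punchIn-fromℕ l)))))

  -- The block matrix (0 s; A 0). The sign s = (-1)^n is that of the cofactor at its position, so
  -- the two cancel and the determinant is that of `A`; it is also the entry of `longWeyl` there.
  corner : Matrix n → Matrix (ℕ.suc n)
  corner {n} A = (const 0# ∷ʳ (- 1#) ^ n) ∷ λ i → A i ∷ʳ 0#

  extendʳ : Matrix n → Vector Carrier n → Matrix (ℕ.suc n)
  extendʳ A w = (λ i → A i ∷ʳ w i) ∷ʳ (const 0# ∷ʳ 1#)

  module _ (A : Matrix n) where

    corner-init₀ : ∀ j → corner A zero (inject₁ j) ≈ 0#
    corner-init₀ j = reflexive (∷ʳ-init _ _ j)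

    corner-last₀ : corner A zero (fromℕ n) ≈ (- 1#) ^ n
    corner-last₀ = reflexive (∷ʳ-last {n = n} _ _)

    corner-init : lowerLeft (corner A) ≋ A
    corner-init i j = reflexive (∷ʳ-init _ _ j)

    corner-last : ∀ i → corner A (suc i) (fromℕ n) ≈ 0#
    corner-last i = reflexive (∷ʳ-last (A i) _)

  module _ (A : Matrix n) (w : Vector Carrier n) where

    extendʳ-init : ∀ i j → extendʳ A w (inject₁ i) (inject₁ j) ≈ A i j
    extendʳ-init i j =
      reflexive (≡.trans (≡.cong-app (∷ʳ-init _ _ i) (inject₁ j)) (∷ʳ-init _ _ j))

    extendʳ-last : ∀ i → extendʳ A w (inject₁ i) (fromℕ n) ≈ w i
    extendʳ-last i =
      reflexive (≡.trans (≡.cong-app (∷ʳ-init _ _ i) (fromℕ n)) (∷ʳ-last (A i) _))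

    extendʳ-initₙ : ∀ j → extendʳ A w (fromℕ n) (inject₁ j) ≈ 0#
    extendʳ-initₙ j =
      reflexive (≡.trans (≡.cong-app (∷ʳ-last {n = n} _ _) (inject₁ j)) (∷ʳ-init _ _ j))

    extendʳ-lastₙ : extendʳ A w (fromℕ n) (fromℕ n) ≈ 1#
    extendʳ-lastₙ =
      reflexive (≡.trans (≡.cong-app (∷ʳ-last {n = n} _ _) (fromℕ n)) (∷ʳ-last {n = n} _ _))

    extendʳ-unipotent : IsUpperUnipotent A → IsUpperUnipotent (extendʳ A w)
    extendʳ-unipotent (A≈1 , A≈0) =
      ∀-last (λ i → trans (extendʳ-init i i) (A≈1 i)) extendʳ-lastₙ ,
      ∀-last (λ i → ∀-last
               (λ j j<i → trans (extendʳ-init i j)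
                 (A≈0 i j (≡.subst₂ ℕ._<_ (toℕ-inject₁ j) (toℕ-inject₁ i) j<i)))
               (λ n<i → contradiction n<i (ℕ.<⇒≯ (inject₁<fromℕ i))))
             (∀-last (λ j _ → extendʳ-initₙ j) (λ n<n → contradiction n<n (ℕ.<-irrefl ≡.refl)))

  ≋-corner : ∀ {A : Matrix n} {B} → (∀ j → B zero (inject₁ j) ≈ 0#) → B zero (fromℕ n) ≈ (- 1#) ^ n →
             lowerLeft B ≋ A → (∀ i → B (suc i) (fromℕ n) ≈ 0#) → B ≋ corner A
  ≋-corner {A = A} B₀ B₀ₙ B≋A Bₙ zero =
    ∀-last (λ j → trans (B₀ j) (sym (corner-init₀ A j))) (trans B₀ₙ (sym (corner-last₀ A)))
  ≋-corner {A = A} B₀ B₀ₙ B≋A Bₙ (suc i) =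
    ∀-last (λ j → trans (B≋A i j) (sym (corner-init A i j))) (trans (Bₙ i) (sym (corner-last A i)))

  corner-cong : ∀ {A B : Matrix n} → A ≋ B → corner A ≋ corner B
  corner-cong {A = A} A≋B = ≋-corner (corner-init₀ A) (corner-last₀ A)
                                     (≋.trans (corner-init A) A≋B) (corner-last A)

  det-corner : ∀ (A : Matrix n) → det (corner A) ≈ det A
  det-corner {n} A = let open ≈-Reasoning in begin
    det (corner A)
      ≈⟨ det-row₀-last (corner A) (corner-init₀ A) ⟩
    s * (corner A zero (fromℕ n) * det (lowerLeft (corner A)))
      ≈⟨ *-congˡ (*-cong (corner-last₀ A) (det-cong (corner-init A))) ⟩
    s * (s * det A)
      ≈⟨ *-assoc s s (det A) ⟨
    s * s * det A
      ≈⟨ 1*≈ (sign² n) ⟩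
    det A ∎
    where s = (- 1#) ^ n

  extendˡ-corner : ∀ (A B : Matrix n) → extendˡ (const 0#) A · corner B ≋ corner (A · B)
  extendˡ-corner {n} A B = ≋-corner
    (λ j → trans (row₀ (inject₁ j)) (corner-init₀ B j))
    (trans (row₀ (fromℕ n)) (corner-last₀ B))
    (λ i j → trans (0+≈ (zeroˡ _)) (·-congˡ {A = A} (corner-init B) i j))
    (λ i → trans (0+≈ (zeroˡ _)) (sum-zero {n} λ k → *0≈0 (corner-last B k)))
    where
    row₀ : ∀ j → (extendˡ (const 0#) A · corner B) zero j ≈ corner B zero j
    row₀ j = trans (+-cong (*-identityˡ _) (sum-zero {n} λ k → zeroˡ _)) (+-identityʳ _)

  module _ (A B : Matrix n) (w : Vector Carrier n) where

    corner-extendʳ₀ : ∀ j → (corner A · extendʳ B w) zero j ≈ corner A zero j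
    corner-extendʳ₀ j = trans
      (·-last (corner A) (extendʳ B w) zero j λ k → 0*≈0 (corner-init₀ A k))
      (∀-last {P = λ j → corner A zero (fromℕ n) * extendʳ B w (fromℕ n) j ≈ corner A zero j}
         (λ j → trans (*0≈0 (extendʳ-initₙ B w j)) (sym (corner-init₀ A j)))
         (*1≈ (extendʳ-lastₙ B w)) j)

    private
      row : ∀ i j → (corner A · extendʳ B w) (suc i) j
                  ≈ sum λ k → A i k * extendʳ B w (inject₁ k) j
      row i j = trans
        (·-init (corner A) (extendʳ B w) (suc i) j (0*≈0 (corner-last A i)))
        (sum-cong-≋ {n} λ k → *-congʳ (corner-init A i k))

    corner-extendʳ-init : lowerLeft (corner A · extendʳ B w) ≋ A · B
    corner-extendʳ-init i j =
      trans (row i (inject₁ j)) (·-congˡ {A = A} (extendʳ-init B w) i j)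

    corner-extendʳ-last : ∀ i → (corner A · extendʳ B w) (suc i) (fromℕ n) ≈ sum λ k → A i k * w k
    corner-extendʳ-last i =
      trans (row i (fromℕ n)) (sum-cong-≋ {n} λ k → *-congˡ (extendʳ-last B w k))

  corner-extendʳ : ∀ (A B : Matrix n) → corner A · extendʳ B (const 0#) ≋ corner (A · B)
  corner-extendʳ {n} A B = ≋-corner
    (λ j → trans (corner-extendʳ₀ A B _ (inject₁ j)) (corner-init₀ A j))
    (trans (corner-extendʳ₀ A B _ (fromℕ n)) (corner-last₀ A))
    (corner-extendʳ-init A B _)
    (λ i → trans (corner-extendʳ-last A B _ i) (sum-zero {n} λ k → zeroʳ _))

  corner-≃ : ∀ {A B : Matrix n} → A ≃ B → corner A ≃ corner B
  corner-≃ {A = A} {B} (u , v , u-uni , v-uni , B≋uAv) =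
    extendˡ (const 0#) u , extendʳ v (const 0#) ,
    extendˡ-unipotent _ u-uni , extendʳ-unipotent v _ v-uni ,
    (let open ≋-Reasoning in begin
      corner B                                               ≈⟨ corner-cong B≋uAv ⟩
      corner (u · A · v)                                     ≈⟨ corner-extendʳ (u · A) v ⟨
      corner (u · A) · extendʳ v (const 0#)
        ≈⟨ ·-congʳ {C = extendʳ v (const 0#)} (extendˡ-corner u A) ⟨
      extendˡ (const 0#) u · corner A · extendʳ v (const 0#) ∎)

  lowerLeft-≃ : ∀ {A B : Matrix (ℕ.suc n)} → A ≃ B → lowerLeft A ≃ lowerLeft B
  lowerLeft-≃ {A = A} (u , v , u-uni , v-uni , B≋uAv) =
    lowerRight u , upperLeft v , tail-unipotent u-uni , init-unipotent v-uni ,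
    ≋.trans (lowerLeft-cong B≋uAv) (lowerLeft-· A u-uni v-uni)

  module _ (a : Vector Carrier n) (X : Matrix (ℕ.suc n)) where

    shear-suc : ∀ i j → (extendˡ a 𝟙 · X) (suc i) j ≈ X (suc i) j
    -- Column `j` is read as a matrix with all columns equal, which turns a matrix-vector product
    -- into a matrix product.
    shear-suc i j = trans (0+≈ (zeroˡ _)) (·-identityˡ (λ k _ → X (suc k) j) i i)

    shear-zero : ∀ j → (extendˡ a 𝟙 · X) zero j ≈ X zero j + sum λ k → a k * X (suc k) j
    shear-zero j = +-congʳ (*-identityˡ _)

  -- The column w = A⁻¹z and the row a = xA⁻¹ clear the entries of γ = (x y; A z)
  -- outside A, except for the corner y - az, whose value is forced by det γ = 1.
  corner-lowerLeft-≃ : ∀ (γ : Matrix (ℕ.suc n)) B → det γ ≈ 1# → det (lowerLeft γ) ≈ 1# →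
    lowerLeft γ · B ≋ 𝟙 → B · lowerLeft γ ≋ 𝟙 → corner (lowerLeft γ) ≃ γ
  corner-lowerLeft-≃ {n} γ B det-γ det-A AB≋𝟙 BA≋𝟙 =
    extendˡ a 𝟙 , extendʳ 𝟙 w , extendˡ-unipotent a 𝟙-unipotent , extendʳ-unipotent 𝟙 w 𝟙-unipotent ,
    ≋.trans (≋.sym γ≋) (≋.sym (·-assoc (extendˡ a 𝟙) (corner A) (extendʳ 𝟙 w)))
    where
    A = lowerLeft γ
    s = (- 1#) ^ n
    -- The row x is stored as a matrix with equal rows and the column z as one with equal columns,
    -- so that the cancellation lemmas for matrices apply; the diagonal of a product then reads off
    -- the resulting vector.
    x z : Matrix n
    x _ j = γ zero (inject₁ j)
    z i _ = γ (suc i) (fromℕ n)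
    a w : Vector Carrier n
    a k = (x · B) k k
    w k = (B · z) k k
    T = corner A · extendʳ 𝟙 w

    aγ-init : ∀ j → sum (λ k → a k * γ (suc k) (inject₁ j)) ≈ γ zero (inject₁ j)
    aγ-init j = ·-cancel-inverseʳ x BA≋𝟙 j j

    T-suc : ∀ i j → T (suc i) j ≈ γ (suc i) j
    T-suc i = ∀-last
      (λ j → trans (corner-extendʳ-init A 𝟙 w i j) (·-identityʳ A i j))
      (trans (corner-extendʳ-last A 𝟙 w i) (·-cancel-inverseˡ z AB≋𝟙 i i))

    aγₙ = sum λ k → a k * γ (suc k) (fromℕ n)

    -- `Y` is `γ` with its first row cleared above `A`. Its determinant is s·y·det A, with y its
    -- upper right entry, and equals det γ; as both determinants are 1 and s² = 1, this forces y =
    -- s.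
    Y = extendˡ (λ k → - a k) 𝟙 · γ

    Y-zero : ∀ j → Y zero j ≈ γ zero j - sum λ k → a k * γ (suc k) j
    Y-zero j = trans (shear-zero _ γ j) (+-congˡ (trans
      (sum-cong-≋ {n} λ k → sym (-‿distribˡ-* _ _)) (sum-neg λ k → a k * γ (suc k) j)))

    y≈s : γ zero (fromℕ n) - aγₙ ≈ s
    y≈s = begin
      y               ≈⟨ 1*≈ (sign² n) ⟨
      s * s * y       ≈⟨ *-assoc s s y ⟩
      s * (s * y)     ≈⟨ *-congˡ (*-congˡ (*1≈ det-A)) ⟨
      s * (s * (y * det A))
        ≈⟨ *-congˡ (*-congˡ (*-cong (Y-zero (fromℕ n))
             (det-cong {A = lowerLeft Y} λ i j → shear-suc (λ k → - a k) γ i (inject₁ j)))) ⟨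
      s * (s * (Y zero (fromℕ n) * det (lowerLeft Y)))
        ≈⟨ *-congˡ (det-row₀-last Y λ j → trans (Y-zero (inject₁ j))
                      (trans (+-congˡ (-‿cong (aγ-init j))) (-‿inverseʳ _))) ⟨
      s * det Y
        ≈⟨ *1≈ (trans (det-unipotentˡ (extendˡ-unipotent _ 𝟙-unipotent) γ) det-γ) ⟩
      s               ∎
      where
      open ≈-Reasoning
      y = γ zero (fromℕ n) - aγₙ

    γ≋ : extendˡ a 𝟙 · T ≋ γ
    γ≋ (suc i) j = trans (shear-suc a T i j) (T-suc i j)
    γ≋ zero j = let open ≈-Reasoning in begin
      (extendˡ a 𝟙 · T) zero j
        ≈⟨ shear-zero a T j ⟩
      T zero j + sum (λ k → a k * T (suc k) j)
        ≈⟨ +-cong (corner-extendʳ₀ A 𝟙 w j) (sum-cong-≋ {n} λ k → *-congˡ (T-suc k j)) ⟩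
      corner A zero j + sum (λ k → a k * γ (suc k) j)
        ≈⟨ ∀-last {P = λ j → corner A zero j + sum (λ k → a k * γ (suc k) j) ≈ γ zero j}
             (λ j → trans (0+≈ (corner-init₀ A j)) (aγ-init j))
             (trans (+-congʳ (trans (corner-last₀ A) (sym y≈s)))
                    (trans (+-assoc _ _ _) (+0≈ (-‿inverseˡ aγₙ)))) j ⟩
      γ zero j ∎

  -- After `u` is removed by invariance, the first row of `corner m · v` is a multiple of the last
  -- row of `v`, which is (0, ..., 0, 1). One expansion thus leaves the lower left block with
  -- cancelling signs, and invariance puts back the lower right block of `u`.
  det-bruhat : ∀ {u v : Matrix (ℕ.suc n)} m → IsUpperUnipotent u → IsUpperUnipotent v →
               det (u · corner m · v) ≈ det (lowerRight u · m · upperLeft v)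
  det-bruhat {n} {u} {v} m u-uni v-uni@(v≈1 , v≈0) = let open ≈-Reasoning in begin
    det (u · corner m · v)
      ≈⟨ det-cong (·-assoc u (corner m) v) ⟩
    det (u · (corner m · v))
      ≈⟨ det-unipotentˡ u-uni (corner m · v) ⟩
    det (corner m · v)
      ≈⟨ det-row₀-last (corner m · v)
           (λ j → trans (row₀ (inject₁ j)) (*0≈0 (v≈0 (fromℕ n) (inject₁ j) (inject₁<fromℕ j)))) ⟩
    s * ((corner m · v) zero (fromℕ n) * det (lowerLeft (corner m · v)))
      ≈⟨ *-congˡ (*-cong (trans (row₀ (fromℕ n)) (trans (*1≈ (v≈1 (fromℕ n))) (corner-last₀ m)))
                         (det-cong (≋.trans (lowerLeft-·ʳ (corner m) v-uni)
                                            (·-congʳ {C = upperLeft v} (corner-init m))))) ⟩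
    s * (s * det (m · upperLeft v))
      ≈⟨ trans (sym (*-assoc s s _)) (1*≈ (sign² n)) ⟩
    det (m · upperLeft v)
      ≈⟨ det-unipotentˡ (tail-unipotent u-uni) (m · upperLeft v) ⟨
    det (lowerRight u · (m · upperLeft v))
      ≈⟨ det-cong (·-assoc (lowerRight u) m (upperLeft v)) ⟨
    det (lowerRight u · m · upperLeft v) ∎
    where
    s = (- 1#) ^ n
    row₀ : ∀ j → (corner m · v) zero j ≈ corner m zero (fromℕ n) * v (fromℕ n) j
    row₀ j = ·-last (corner m) v zero j λ k → 0*≈0 (corner-init₀ m k)

  -- Bruhat decomposition in the big cell

  longWeyl-opposite : ∀ (i : Fin n) → longWeyl i (opposite i) ≈ sign (opposite i)
  longWeyl-opposite i =
    reflexive (if-yes (i ≟ opposite (opposite i)) (≡.sym (Fin.opposite-involutive i)))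

  longWeyl-≢ : ∀ {i k : Fin n} → i ≢ opposite k → longWeyl i k ≈ 0#
  longWeyl-≢ {i = i} {k} i≢ = reflexive (if-no (i ≟ opposite k) i≢)

  module BigCell (d : Vector Carrier n) (d⁻¹ : ∀ i → ∃[ x ] x * d i ≈ 1#) where

    w : Matrix n
    w = diag d · longWeyl

    -- The only entry of row `i` of `w` that can differ from zero; it stands in column `opposite i`.
    pivot : Fin n → Carrier
    pivot i = d i * sign (opposite i)

    w-opposite : ∀ i → w i (opposite i) ≈ pivot i
    w-opposite i = trans (diag-· d longWeyl i (opposite i)) (*-congˡ (longWeyl-opposite i))

    w-≢ : ∀ {i k} → i ≢ opposite k → w i k ≈ 0#
    w-≢ {i} {k} i≢ = trans (diag-· d longWeyl i k) (*0≈0 (longWeyl-≢ i≢))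

    w-· : ∀ X i j → (w · X) i j ≈ pivot i * X (opposite i) j
    w-· X i j = trans
      (sum-single (λ k → w i k * X k j) (opposite i) λ k k≢ →
        0*≈0 (w-≢ λ i≡ → k≢ (≡.trans (≡.sym (Fin.opposite-involutive k)) (≡.cong opposite (≡.sym i≡)))))
      (*-congʳ (w-opposite i))

    ·-w : ∀ X i k → (X · w) i (opposite k) ≈ X i k * pivot k
    ·-w X i k = trans
      (sum-single (λ l → X i l * w l (opposite k)) k λ l l≢k →
        *0≈0 (w-≢ λ l≡ → l≢k (≡.trans l≡ (Fin.opposite-involutive k))))
      (*-congˡ (w-opposite k))

    pivot-cancelˡ : ∀ i {x y} → pivot i * x ≈ pivot i * y → x ≈ y
    pivot-cancelˡ i {x} {y} eq = trans (sym (undo x)) (trans (*-congˡ (*-congˡ eq)) (undo y))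
      where
      s = sign (opposite i)
      d⁻¹ᵢ = proj₁ (d⁻¹ i)
      undo : ∀ z → s * (d⁻¹ᵢ * (pivot i * z)) ≈ z
      undo z = let open ≈-Reasoning in begin
        s * (d⁻¹ᵢ * (d i * s * z))   ≈⟨ *-congˡ (*-congˡ (*-assoc (d i) s z)) ⟩
        s * (d⁻¹ᵢ * (d i * (s * z))) ≈⟨ *-congˡ (*-assoc d⁻¹ᵢ (d i) (s * z)) ⟨
        s * (d⁻¹ᵢ * d i * (s * z))   ≈⟨ *-congˡ (1*≈ (proj₂ (d⁻¹ i))) ⟩
        s * (s * z)                  ≈⟨ *-assoc s s z ⟨
        s * s * z                    ≈⟨ 1*≈ (sign² (toℕ (opposite i))) ⟩
        z                            ∎

    pivot-nonzero : ∀ i {x} → pivot i * x ≈ 0# → x ≈ 0#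
    pivot-nonzero i eq = pivot-cancelˡ i (trans eq (sym (zeroʳ (pivot i))))

    -- w conjugates upper into lower triangular matrices.
    w-conjugate : ∀ {p q : Matrix n} → IsUpperUnipotent p → IsUpperUnipotent q →
                  p · w ≋ w · q → p ≋ 𝟙 × q ≋ 𝟙
    w-conjugate {p} {q} (p≈1 , p≈0) (q≈1 , q≈0) pw≋wq = p≋𝟙 , q≋𝟙
      where
      entry : ∀ i k → pivot k * p i k ≈ pivot i * q (opposite i) (opposite k)
      entry i k = trans (*-comm _ _) (trans (sym (·-w p i k))
                    (trans (pw≋wq i (opposite k)) (w-· q i (opposite k))))
      p≋𝟙 : p ≋ 𝟙
      p≋𝟙 i k with Fin.<-cmp i k
      ... | tri> _ i≢k k<i    = trans (p≈0 i k k<i) (sym (diag-≢ _ i≢k))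
      ... | tri≈ _ ≡.refl _   = trans (p≈1 i) (sym (diag-≡ _ i))
      ... | tri< i<k i≢k _ = trans
        (pivot-nonzero k (trans (entry i k) (*0≈0 (q≈0 _ _ (opposite-mono-< i<k)))))
        (sym (diag-≢ _ i≢k))
      q≋𝟙 : q ≋ 𝟙
      q≋𝟙 i k with Fin.<-cmp i k
      ... | tri> _ i≢k k<i    = trans (q≈0 i k k<i) (sym (diag-≢ _ i≢k))
      ... | tri≈ _ ≡.refl _   = trans (q≈1 i) (sym (diag-≡ _ i))
      ... | tri< i<k i≢k _ = trans
        (pivot-nonzero (opposite i) (trans
          (*-congˡ (reflexive (≡.sym
            (≡.cong₂ q (Fin.opposite-involutive i) (Fin.opposite-involutive k)))))
          (trans (sym (entry (opposite i) (opposite k)))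
                 (*0≈0 (p≈0 _ _ (opposite-mono-< i<k))))))
        (sym (diag-≢ _ i≢k))

    -- With x = u′⁻¹ and y = v⁻¹ the equation becomes (xu)w = w(v′y), an instance of `w-conjugate`;
    -- both unipotent matrices are therefore 𝟙.
    bruhat-unique : ∀ {u u′ v v′ : Matrix n} →
      IsUpperUnipotent u → IsUpperUnipotent u′ → IsUpperUnipotent v → IsUpperUnipotent v′ →
      u · w · v ≋ u′ · w · v′ → u ≋ u′ × v ≋ v′
    bruhat-unique {u} {u′} {v} {v′} u-uni u′-uni v-uni v′-uni uwv≋u′wv′
      with unipotent-inverse u′-uni | unipotent-inverse v-uni
    ... | x , x-uni , u′x≋𝟙 , xu′≋𝟙 | y , y-uni , vy≋𝟙 , yv≋𝟙
      with w-conjugate (unipotent-· x-uni u-uni) (unipotent-· v′-uni y-uni) xuw≋wv′y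
      where
      xuw≋wv′y : x · u · w ≋ w · (v′ · y)
      xuw≋wv′y = let open ≋-Reasoning in begin
        x · u · w              ≈⟨ ·-assoc x u w ⟩
        x · (u · w)            ≈⟨ ·-congˡ {A = x} (·-cancel-inverseʳ (u · w) vy≋𝟙) ⟨
        x · (u · w · v · y)    ≈⟨ ·-congˡ {A = x} (·-congʳ {C = y} uwv≋u′wv′) ⟩
        x · (u′ · w · v′ · y)  ≈⟨ ·-congˡ {A = x} (·-assoc (u′ · w) v′ y) ⟩
        x · (u′ · w · (v′ · y)) ≈⟨ ·-congˡ {A = x} (·-assoc u′ w (v′ · y)) ⟩
        x · (u′ · (w · (v′ · y))) ≈⟨ ·-cancel-inverseˡ (w · (v′ · y)) xu′≋𝟙 ⟩
        w · (v′ · y)           ∎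
    ... | xu≋𝟙 , v′y≋𝟙 = (let open ≋-Reasoning in begin
        u               ≈⟨ ·-identityˡ u ⟨
        𝟙 · u           ≈⟨ ·-congʳ {C = u} u′x≋𝟙 ⟨
        u′ · x · u      ≈⟨ ·-assoc u′ x u ⟩
        u′ · (x · u)    ≈⟨ ·-congˡ {A = u′} xu≋𝟙 ⟩
        u′ · 𝟙          ≈⟨ ·-identityʳ u′ ⟩
        u′              ∎) ,
      (let open ≋-Reasoning in begin
        v               ≈⟨ ·-identityˡ v ⟨
        𝟙 · v           ≈⟨ ·-congʳ {C = v} v′y≋𝟙 ⟨
        v′ · y · v      ≈⟨ ·-cancel-inverseʳ v′ yv≋𝟙 ⟩
        v′              ∎)

    -- The unipotent factors are undone by their inverses. The middle one permutes rows up to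
    -- invertible pivots, so row `i` of v·X is recovered from row `opposite i` of w·(v·X).
    bruhat-cancelˡ : ∀ {u v X Y : Matrix n} → IsUpperUnipotent u → IsUpperUnipotent v →
                     u · w · v · X ≋ u · w · v · Y → X ≋ Y
    bruhat-cancelˡ {u} {v} {X} {Y} u-uni v-uni eq
      with unipotent-inverse u-uni | unipotent-inverse v-uni
    ... | x , _ , _ , xu≋𝟙 | y , _ , _ , yv≋𝟙 =
      ≋.trans (≋.sym (·-cancel-inverseˡ X yv≋𝟙))
              (≋.trans (·-congˡ {A = y} vX≋vY) (·-cancel-inverseˡ Y yv≋𝟙))
      where
      strip : ∀ Z → x · (u · w · v · Z) ≋ w · (v · Z)
      strip Z = let open ≋-Reasoning in begin
        x · (u · w · v · Z)     ≈⟨ ·-congˡ {A = x} (≋.trans (·-assoc (u · w) v Z) (·-assoc u w (v · Z))) ⟩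
        x · (u · (w · (v · Z))) ≈⟨ ·-cancel-inverseˡ (w · (v · Z)) xu≋𝟙 ⟩
        w · (v · Z)             ∎
      wvX≋wvY : w · (v · X) ≋ w · (v · Y)
      wvX≋wvY = ≋.trans (≋.sym (strip X)) (≋.trans (·-congˡ {A = x} eq) (strip Y))
      vX≋vY : v · X ≋ v · Y
      vX≋vY i j = ≡.subst (λ l → (v · X) l j ≈ (v · Y) l j) (Fin.opposite-involutive i)
        (pivot-cancelˡ (opposite i) (trans (sym (w-· (v · X) (opposite i) j))
          (trans (wvX≋wvY (opposite i) j) (w-· (v · Y) (opposite i) j))))

module ℤᴸ = LinearAlgebra ℤ.+-*-commutativeRing

-- The integers inside a field of characteristic zero

module Embedding {c ℓ₁ ℓ₂} (F : HeytingField c ℓ₁ ℓ₂) (char0 : CharacteristicZero F) where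

  open CommutativeRing (toRing F) hiding (zero)
  open HeytingField F using (#-irrefl; #⇒invertible)
  open RingProperties ring
  open Exp semiring using (_^_)
  open Exp (CommutativeRing.semiring ℤ.+-*-commutativeRing) using () renaming (_^_ to _^ᶻ_)
  open Mult semiring using (×-homo-+; ×1-homo-*; ×-congˡ) renaming (_×_ to _×′_)
  open Sum semiring using (sum; sum-cong-≋)
  open Sum (CommutativeRing.semiring ℤ.+-*-commutativeRing) using () renaming (sum to sumᶻ)
  open Matrices (toRing F)
  open LinearAlgebra (toRing F)

  private
    ι : ℤ → Carrier
    ι = fromℤ F

    ⟪_⟫ : ℕ → Carrier
    ⟪ n ⟫ = n ×′ 1#

  ι-⊖ : ∀ m n → ι (m ℤ.⊖ n) ≈ ⟪ m ⟫ - ⟪ n ⟫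
  ι-⊖ m         ℕ.zero    = sym (+0≈ -0#≈0#)
  ι-⊖ ℕ.zero    (ℕ.suc n) = sym (+-identityˡ _)
  ι-⊖ (ℕ.suc m) (ℕ.suc n) = let open ≈-Reasoning in begin
    ι (ℕ.suc m ℤ.⊖ ℕ.suc n)     ≡⟨ ≡.cong ι (ℤ.[1+m]⊖[1+n]≡m⊖n m n) ⟩
    ι (m ℤ.⊖ n)                 ≈⟨ ι-⊖ m n ⟩
    ⟪ m ⟫ - ⟪ n ⟫               ≈⟨ [x+y]-[x+z]≈y-z ⟨
    (1# + ⟪ m ⟫) - (1# + ⟪ n ⟫) ∎
    where
    [x+y]-[x+z]≈y-z : ∀ {x y z} → (x + y) - (x + z) ≈ y - z
    [x+y]-[x+z]≈y-z {x} {y} {z} = let open ≈-Reasoning in begin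
      (x + y) + - (x + z)    ≈⟨ +-cong (+-comm x y) (sym (-‿+-comm x z)) ⟩
      (y + x) + (- x + - z)  ≈⟨ +-assoc y x _ ⟩
      y + (x + (- x + - z))  ≈⟨ +-congˡ (+-assoc x (- x) (- z)) ⟨
      y + ((x + - x) + - z)  ≈⟨ +-congˡ (0+≈ (-‿inverseʳ x)) ⟩
      y + - z                ∎

  ι-neg : ∀ i → ι (ℤ.- i) ≈ - ι i
  ι-neg (+ ℕ.zero)    = sym -0#≈0#
  ι-neg (+ ℕ.suc n)   = refl
  ι-neg -[1+ n ]      = sym (-‿involutive _)

  ι-+ : ∀ i j → ι (i ℤ.+ j) ≈ ι i + ι j
  ι-+ (+ m)    (+ n)    = ×-homo-+ 1# m n
  ι-+ (+ m)    -[1+ n ] = ι-⊖ m (ℕ.suc n)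
  ι-+ -[1+ m ] (+ n)    = trans (ι-⊖ n (ℕ.suc m)) (+-comm _ _)
  ι-+ -[1+ m ] -[1+ n ] = trans
    (-‿cong (trans (×-congˡ {1#} (≡.cong ℕ.suc (≡.sym (ℕ.+-suc m n))))
                 (×-homo-+ 1# (ℕ.suc m) (ℕ.suc n))))
    (sym (-‿+-comm _ _))

  ι-+* : ∀ m j → ι (+ m ℤ.* j) ≈ ⟪ m ⟫ * ι j
  ι-+* m (+ n) = trans (reflexive (≡.cong ι (≡.sym (ℤ.pos-* m n)))) (×1-homo-* m n)
  ι-+* m -[1+ n ] = let open ≈-Reasoning in begin
    ι (+ m ℤ.* -[1+ n ])        ≡⟨ ≡.cong ι (ℤ.neg-distribʳ-* (+ m) (+ ℕ.suc n)) ⟨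
    ι (ℤ.- (+ m ℤ.* + ℕ.suc n)) ≈⟨ ι-neg (+ m ℤ.* + ℕ.suc n) ⟩
    - ι (+ m ℤ.* + ℕ.suc n)     ≈⟨ -‿cong (ι-+* m (+ ℕ.suc n)) ⟩
    - (⟪ m ⟫ * ⟪ ℕ.suc n ⟫)     ≈⟨ -‿distribʳ-* _ _ ⟩
    ⟪ m ⟫ * - ⟪ ℕ.suc n ⟫       ∎

  ι-* : ∀ i j → ι (i ℤ.* j) ≈ ι i * ι j
  ι-* (+ m)    j = ι-+* m j
  ι-* -[1+ m ] j = let open ≈-Reasoning in begin
    ι (-[1+ m ] ℤ.* j)          ≡⟨ ≡.cong ι (ℤ.neg-distribˡ-* (+ ℕ.suc m) j) ⟨
    ι (ℤ.- (+ ℕ.suc m ℤ.* j))   ≈⟨ ι-neg (+ ℕ.suc m ℤ.* j) ⟩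
    - ι (+ ℕ.suc m ℤ.* j)       ≈⟨ -‿cong (ι-+* (ℕ.suc m) j) ⟩
    - (⟪ ℕ.suc m ⟫ * ι j)       ≈⟨ -‿distribˡ-* _ _ ⟩
    - ⟪ ℕ.suc m ⟫ * ι j         ∎

  ι-1 : ι (+ 1) ≈ 1#
  ι-1 = +-identityʳ 1#

  ι-inverse : ∀ d (nz : NonZero d) → proj₁ (#⇒invertible (char0 d {{nz}})) * ι (+ d) ≈ 1#
  ι-inverse d nz = let inv = #⇒invertible (char0 d {{nz}}) in
    trans (*-congˡ (sym (+0≈ -0#≈0#))) (proj₁ (proj₂ inv))

  ι≈0⇒≡0 : ∀ i → ι i ≈ 0# → i ≡ + 0
  ι≈0⇒≡0 (+ ℕ.zero)  _    = ≡.refl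
  ι≈0⇒≡0 (+ ℕ.suc n) ιi≈0 = contradiction (char0 (ℕ.suc n)) (#-irrefl ιi≈0)
  ι≈0⇒≡0 -[1+ n ]    ιi≈0 = contradiction (char0 (ℕ.suc n))
    (#-irrefl (trans (sym (-‿involutive _)) (trans (-‿cong ιi≈0) -0#≈0#)))

  -- Bruhat factors live over the field; injectivity brings back to ℤ the identities that are proved
  -- through them.
  ι-injective : ∀ {i j} → ι i ≈ ι j → i ≡ j
  ι-injective {i} {j} ιi≈ιj = ℤ.i-j≡0⇒i≡j i j (ι≈0⇒≡0 (i ℤ.- j)
    (trans (ι-+ i (ℤ.- j)) (trans (+-cong ιi≈ιj (ι-neg j)) (-‿inverseʳ (ι j)))))

  ι-sum : ∀ (f : Vector ℤ n) → ι (sumᶻ f) ≈ sum (ι ∘ f)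
  ι-sum {ℕ.zero}  f = refl
  ι-sum {ℕ.suc n} f = trans (ι-+ (f zero) (sumᶻ (tail f))) (+-congˡ (ι-sum (tail f)))

  ιᴹ : ℤᴹ.Matrix n → Matrix n
  ιᴹ A i j = ι (A i j)

  ιᴹ-cong : ∀ {A B : ℤᴹ.Matrix n} → A ℤᴹ.≋ B → ιᴹ A ≋ ιᴹ B
  ιᴹ-cong A≋B i j = reflexive (≡.cong ι (A≋B i j))

  ιᴹ-injective : ∀ {A B : ℤᴹ.Matrix n} → ιᴹ A ≋ ιᴹ B → A ℤᴹ.≋ B
  ιᴹ-injective ιA≋ιB i j = ι-injective (ιA≋ιB i j)

  ιᴹ-· : ∀ (A B : ℤᴹ.Matrix n) → ιᴹ (A ℤᴹ.· B) ≋ ιᴹ A · ιᴹ B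
  ιᴹ-· {n} A B i j = trans (ι-sum λ k → A i k ℤ.* B k j) (sum-cong-≋ {n} λ k → ι-* (A i k) (B k j))

  ιᴹ-𝟙 : ιᴹ (ℤᴸ.𝟙 {n}) ≋ 𝟙
  ιᴹ-𝟙 i j with i ≟ j
  ... | yes _ = ι-1
  ... | no  _ = refl

  ιᴹ-unipotent : ∀ {u : ℤᴹ.Matrix n} → ℤᴹ.IsUpperUnipotent u → IsUpperUnipotent (ιᴹ u)
  ιᴹ-unipotent (u≡1 , u≡0) =
    (λ i → trans (reflexive (≡.cong ι (u≡1 i))) ι-1) ,
    (λ i j j<i → reflexive (≡.cong ι (u≡0 i j j<i)))

  ι-sign : ∀ k → ι (-[1+ 0 ] ^ᶻ k) ≈ (- 1#) ^ k
  ι-sign ℕ.zero    = ι-1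
  ι-sign (ℕ.suc k) = trans (ι-* -[1+ 0 ] (-[1+ 0 ] ^ᶻ k)) (*-cong (-‿cong ι-1) (ι-sign k))

  ι-det : ∀ (A : ℤᴹ.Matrix n) → ι (ℤᴹ.det A) ≈ det (ιᴹ A)
  ι-det {ℕ.zero}  A = ι-1
  ι-det {ℕ.suc n} A = trans (ι-sum (ℤᴸ.laplaceTerm A)) (sum-cong-≋ term)
    where
    term : ∀ j → ι (ℤᴸ.laplaceTerm A j) ≈ laplaceTerm (ιᴹ A) j
    term j = trans (ι-* (ℤᴸ.sign j) _) (*-cong (ι-sign (toℕ j))
      (trans (ι-* (A zero j) _) (*-congˡ (ι-det (ℤᴸ.minor A j)))))

  ιᴹ-corner : ∀ (A : ℤᴹ.Matrix n) → ιᴹ (ℤᴸ.corner A) ≋ corner (ιᴹ A)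
  ιᴹ-corner {n} A = ≋-corner
    (λ j → reflexive (≡.cong ι (ℤᴸ.corner-init₀ A j)))
    (trans (reflexive (≡.cong ι (ℤᴸ.corner-last₀ A))) (ι-sign n))
    (λ i j → reflexive (≡.cong ι (ℤᴸ.corner-init A i j)))
    (λ i → reflexive (≡.cong ι (ℤᴸ.corner-last A i)))

-- Matching the representatives of two quotients

module Transversals
  {a b ℓᵃ ℓᵇ} {A : Set a} {B : Set b} {_∼ᵃ_ : Rel A ℓᵃ} {_∼ᵇ_ : Rel B ℓᵇ}
  (∼ᵃ-trans : ∀ x y z → x ∼ᵃ y → y ∼ᵃ z → x ∼ᵃ z)
  (∼ᵇ-trans : ∀ x y z → x ∼ᵇ y → y ∼ᵇ z → x ∼ᵇ z)
  {m n} {f : Fin m → A} {g : Fin n → B}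
  (f-bijective : Bijective _≡_ _∼ᵃ_ f) (g-bijective : Bijective _≡_ _∼ᵇ_ g)
  (F : A → B) (G : B → A)
  (F-cong : ∀ x y → x ∼ᵃ y → F x ∼ᵇ F y) (G-cong : ∀ x y → x ∼ᵇ y → G x ∼ᵃ G y)
  (GF∼id : ∀ x → G (F x) ∼ᵃ x) (FG∼id : ∀ y → F (G y) ∼ᵇ y) where

  private
    to : Fin m → Fin n
    to i = proj₁ (proj₂ g-bijective (F (f i)))

    to-∼ : ∀ i → g (to i) ∼ᵇ F (f i)
    to-∼ i = proj₂ (proj₂ g-bijective (F (f i))) ≡.refl

    from : Fin n → Fin m
    from j = proj₁ (proj₂ f-bijective (G (g j)))

    from-∼ : ∀ j → f (from j) ∼ᵃ G (g j)
    from-∼ j = proj₂ (proj₂ f-bijective (G (g j))) ≡.refl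

    -- The chain g (to (from j)) ∼ F (f (from j)) ∼ F (G (g j)) ∼ g j shows that both indices name
    -- the same class, and `g` is injective modulo the relation.
    to-from : ∀ j → to (from j) ≡ j
    to-from j = proj₁ g-bijective
      (∼ᵇ-trans _ _ _ (to-∼ (from j)) (∼ᵇ-trans _ _ _ (F-cong _ _ (from-∼ j)) (FG∼id (g j))))

    from-to : ∀ i → from (to i) ≡ i
    from-to i = proj₁ f-bijective
      (∼ᵃ-trans _ _ _ (from-∼ (to i)) (∼ᵃ-trans _ _ _ (G-cong _ _ (to-∼ i)) (GF∼id (f i))))

  -- Directed from the indices of `g` to those of `f`, so that a sum over the representatives `f`
  -- can be rewritten as a sum over the indices of `g`, whose number is not known to be `m`
  -- beforehand.
  permute : Permutation n m
  permute = permutation from to from-to to-from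

  permute-∼ : ∀ j → f (permute ⟨$⟩ʳ j) ∼ᵃ G (g j)
  permute-∼ = from-∼

module _ {c ℓ₁ ℓ₂ c′ ℓ₁′ ℓ₂′} (E : Exponential c ℓ₁ ℓ₂ c′ ℓ₁′ ℓ₂′) where

  open Kloosterman E
  open CommutativeRing (toRing R) hiding (zero)
  open Matrices (toRing R)
  open LinearAlgebra (toRing R)
  open Embedding R R-char0
  open Sum semiring using (sum; sum-cong-≋; sum-init-last; ∑-distrib-+)
  open Sum (CommutativeRing.semiring ℤ.+-*-commutativeRing) using () renaming (sum to sumᶻ)
  open Exp semiring using (_^_)
  open Sum (CommutativeRing.semiring (toRing C)) using ()
    renaming (sum-cong-≋ to sumᶜ-cong; sum-permute to sumᶜ-permute)
  open BruhatCell

  private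
    module ℂ = CommutativeRing (toRing C)

  -- The characters on unipotent matrices

  ψ-cong : ∀ {r} (N : Vector ℤ r) {u v} → u ≋ v → ψ N u C.≈ ψ N v
  ψ-cong {r} N u≋v = e-cong (sum-cong-≋ {r} λ i → *-congˡ (u≋v (inject₁ i) (suc i)))

  ψ-· : ∀ {r} (N : Vector ℤ r) {u v} → IsUpperUnipotent u → IsUpperUnipotent v →
        ψ N (u · v) C.≈ ψ N u C.* ψ N v
  ψ-· {r} N {u} {v} u-uni v-uni = ℂ.trans
    (e-cong (trans
      (sum-cong-≋ {r} λ i → trans (*-congˡ (unipotent-superdiagonal u-uni v-uni i)) (distribˡ _ _ _))
      (∑-distrib-+ (λ i → ι (N i) * u (inject₁ i) (suc i)) (λ i → ι (N i) * v (inject₁ i) (suc i)))))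
    (e-homo _ _)

  ψ-integral : ∀ {r} (N : Vector ℤ r) (u : ℤᴹ.Matrix (ℕ.suc r)) → ψ N (ιᴹ u) C.≈ C.1#
  ψ-integral {r} N u = Equivalence.from (e-kernel _)
    ((sumᶻ λ i → N i ℤ.* u (inject₁ i) (suc i)) ,
     sym (trans (ι-sum λ i → N i ℤ.* u (inject₁ i) (suc i))
                    (sum-cong-≋ {r} λ i → ι-* (N i) (u (inject₁ i) (suc i)))))

  ψ-integral-·ˡ : ∀ {r} (N : Vector ℤ r) {u b} → ℤᴹ.IsUpperUnipotent u → IsUpperUnipotent b →
                  ψ N (ιᴹ u · b) C.≈ ψ N b
  ψ-integral-·ˡ N {u} u-uni b-uni = ℂ.trans (ψ-· N (ιᴹ-unipotent u-uni) b-uni)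
    (ℂ.trans (ℂ.*-congʳ (ψ-integral N u)) (ℂ.*-identityˡ _))

  ψ-integral-·ʳ : ∀ {r} (N : Vector ℤ r) {b v} → IsUpperUnipotent b → ℤᴹ.IsUpperUnipotent v →
                  ψ N (b · ιᴹ v) C.≈ ψ N b
  ψ-integral-·ʳ N {v = v} b-uni v-uni = ℂ.trans (ψ-· N b-uni (ιᴹ-unipotent v-uni))
    (ℂ.trans (ℂ.*-congˡ (ψ-integral N v)) (ℂ.*-identityʳ _))

  -- The summand on double cosets

  module _ {r} (D : Vector ℕ r) (D⁺ : ∀ i → NonZero (D i)) where

    -- Copies the diagonal formula of `cᴰ`, so that the `w` of the instance of `BigCell` below
    -- unfolds to `cᴰ · longWeyl`.
    ratio : Vector Carrier (ℕ.suc r)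
    ratio j = ι (+ (D ∷ʳ 1) j) * reciprocal ((1 ∷ D) j) (1∷D⁺ D D⁺ j)

    ∷ʳ1⁺ : ∀ j → NonZero ((D ∷ʳ 1) j)
    ∷ʳ1⁺ = ∀-last (λ j → ≡.subst NonZero (≡.sym (∷ʳ-init D 1 j)) (D⁺ j))
                  (≡.subst NonZero (≡.sym (∷ʳ-last D 1)) _)

    ratio-inverse : ∀ j → ∃[ x ] x * ratio j ≈ 1#
    ratio-inverse j = ι (+ b) * a⁻¹ , (let open ≈-Reasoning in begin
      ι (+ b) * a⁻¹ * (ι (+ a) * b⁻¹) ≈⟨ *-assoc _ _ _ ⟩
      ι (+ b) * (a⁻¹ * (ι (+ a) * b⁻¹)) ≈⟨ *-congˡ (*-assoc _ _ _) ⟨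
      ι (+ b) * (a⁻¹ * ι (+ a) * b⁻¹) ≈⟨ *-congˡ (1*≈ (ι-inverse a (∷ʳ1⁺ j))) ⟩
      ι (+ b) * b⁻¹                   ≈⟨ *-comm _ _ ⟩
      b⁻¹ * ι (+ b)                   ≈⟨ ι-inverse b (1∷D⁺ D D⁺ j) ⟩
      1#                              ∎)
      where
      a = (D ∷ʳ 1) j
      b = (1 ∷ D) j
      a⁻¹ = reciprocal a (∷ʳ1⁺ j)
      b⁻¹ = reciprocal b (1∷D⁺ D D⁺ j)

    open BigCell (reverse ratio) (λ i → ratio-inverse (opposite i)) public

    cell-bruhat : ∀ (x : BruhatCell D D⁺) → ιᴹ (γ x) ≋ b₁ x · w · b₂ x
    cell-bruhat x = ≋.trans (bruhat x) (·-congʳ {C = b₂ x} (·-assoc (b₁ x) (cᴰ D D⁺) longWeyl))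

    summand : Vector ℤ r → Vector ℤ r → BruhatCell D D⁺ → C.Carrier
    summand M N x = ψ (reverse M) (b₁ x) C.* ψ N (b₂ x)

    -- The factors stored in `y` need not be built from those of `x`. Uniqueness identifies them
    -- with `ιᴹ u · b₁ x` and `b₂ x · ιᴹ v`, from which `ψ` drops the integral parts.
    summand-∼ : ∀ M N x y → _∼_ D D⁺ x y → summand M N y C.≈ summand M N x
    summand-∼ M N x y (u , v , u-uni , v-uni , γy≋uγxv) = ℂ.*-cong
      (ℂ.trans (ψ-cong (reverse M) (proj₁ factors)) (ψ-integral-·ˡ (reverse M) u-uni (b₁-unipotent x)))
      (ℂ.trans (ψ-cong N (proj₂ factors)) (ψ-integral-·ʳ N (b₂-unipotent x) v-uni))
      where
      ιγy≋ : b₁ y · w · b₂ y ≋ (ιᴹ u · b₁ x) · w · (b₂ x · ιᴹ v)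
      ιγy≋ = let open ≋-Reasoning in begin
        b₁ y · w · b₂ y                       ≈⟨ cell-bruhat y ⟨
        ιᴹ (γ y)                              ≈⟨ ιᴹ-cong γy≋uγxv ⟩
        ιᴹ (u ℤᴹ.· γ x ℤᴹ.· v)                ≈⟨ ιᴹ-· (u ℤᴹ.· γ x) v ⟩
        ιᴹ (u ℤᴹ.· γ x) · ιᴹ v                ≈⟨ ·-congʳ {C = ιᴹ v} (ιᴹ-· u (γ x)) ⟩
        ιᴹ u · ιᴹ (γ x) · ιᴹ v
          ≈⟨ ·-congʳ {C = ιᴹ v} (·-congˡ {A = ιᴹ u} (cell-bruhat x)) ⟩
        ιᴹ u · (b₁ x · w · b₂ x) · ιᴹ v       ≈⟨ ·-congʳ {C = ιᴹ v} (·-assoc (ιᴹ u) (b₁ x · w) (b₂ x)) ⟨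
        ιᴹ u · (b₁ x · w) · b₂ x · ιᴹ v       ≈⟨ ·-assoc (ιᴹ u · (b₁ x · w)) (b₂ x) (ιᴹ v) ⟩
        ιᴹ u · (b₁ x · w) · (b₂ x · ιᴹ v)     ≈⟨ ·-congʳ {C = b₂ x · ιᴹ v} (·-assoc (ιᴹ u) (b₁ x) w) ⟨
        ιᴹ u · b₁ x · w · (b₂ x · ιᴹ v)       ∎
      factors : b₁ y ≋ ιᴹ u · b₁ x × b₂ y ≋ b₂ x · ιᴹ v
      factors = bruhat-unique
        (b₁-unipotent y) (unipotent-· (ιᴹ-unipotent u-uni) (b₁-unipotent x))
        (b₂-unipotent y) (unipotent-· (b₂-unipotent x) (ιᴹ-unipotent v-uni)) ιγy≋

    ∼-trans : ∀ x y z → _∼_ D D⁺ x y → _∼_ D D⁺ y z → _∼_ D D⁺ x z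
    ∼-trans x y z = ℤᴸ.≃-trans {A = γ x} {γ y} {γ z}

  -- Cells whose last modulus is 1

  module _ {r} (D : Vector ℕ (ℕ.suc r)) (D⁺ : ∀ i → NonZero (D i)) (last≡1 : last D ≡ 1) where

    private
      D′ = init D
      D′⁺ : ∀ i → NonZero (D′ i)
      D′⁺ i = D⁺ (inject₁ i)

    ratio-last : ratio D D⁺ (fromℕ (ℕ.suc r)) ≈ 1#
    ratio-last = begin
      ι (+ (D ∷ʳ 1) (suc i)) * reciprocal (D i) (D⁺ i)
        -- The numerator is the appended 1. Replacing it by the last entry of `D`, also 1, lets it
        -- cancel against the reciprocal of that entry.
        ≡⟨ ≡.cong (λ d → ι (+ d) * reciprocal (D i) (D⁺ i)) (≡.trans (∷ʳ-last D 1) (≡.sym last≡1)) ⟩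
      ι (+ D i) * reciprocal (D i) (D⁺ i)
        ≈⟨ trans (*-comm _ _) (ι-inverse (D i) (D⁺ i)) ⟩
      1# ∎
      where
      open ≈-Reasoning
      i = fromℕ r

    -- Dropping the last entry of `D` and appending 1 restores `D`, so the numerators agree; the
    -- denominators `1 ∷ D` are merely truncated.
    ratio-init : ∀ j → ratio D D⁺ (inject₁ j) ≡ ratio D′ D′⁺ j
    ratio-init j = ≡.cong₂ (λ a x → ι (+ a) * x)
      (≡.trans (∷ʳ-init D 1 j) (≡.sym (init∷ʳ1≡D j))) (denominator j)
      where
      init∷ʳ1≡D : ∀ j → (D′ ∷ʳ 1) j ≡ D j
      init∷ʳ1≡D = ∀-last (∷ʳ-init D′ 1) (≡.trans (∷ʳ-last D′ 1) (≡.sym last≡1))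
      denominator : ∀ j → reciprocal ((1 ∷ D) (inject₁ j)) (1∷D⁺ D D⁺ (inject₁ j))
                        ≡ reciprocal ((1 ∷ D′) j) (1∷D⁺ D′ D′⁺ j)
      denominator zero    = ≡.refl
      denominator (suc j) = ≡.refl

    w≋corner : w D D⁺ ≋ corner (w D′ D′⁺)
    w≋corner = ≋-corner
      (λ j → w-≢ D D⁺ {zero} {inject₁ j} λ eq → 0≢suc (≡.trans eq (opposite-inject₁ j)))
      (trans (w-opposite D D⁺ zero) (trans (1*≈ ratio-last)
        (reflexive (≡.cong ((- 1#) ^_) (toℕ-fromℕ (ℕ.suc r))))))
      (λ i j → trans (diag-· (reverse (ratio D D⁺)) longWeyl (suc i) (inject₁ j))
        (trans (*-cong (reflexive (ratio-init (opposite i))) (reflexive (longWeyl-lowerLeft i j)))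
               (sym (diag-· (reverse (ratio D′ D′⁺)) longWeyl i j))))
      (λ i → w-≢ D D⁺ {suc i} {fromℕ (ℕ.suc r)} λ eq →
        0≢suc (≡.sym (≡.trans eq (opposite-fromℕ (ℕ.suc r)))))
      where
      0≢suc : ∀ {n} {i : Fin n} → zero ≢ suc i
      0≢suc ()
      -- The signs depend on the column number alone, and dropping the first row and the last column
      -- leaves column numbers unchanged.
      longWeyl-lowerLeft : ∀ (i j : Fin (ℕ.suc r)) → longWeyl (suc i) (inject₁ j) ≡ longWeyl i j
      longWeyl-lowerLeft i j rewrite opposite-inject₁ j | toℕ-inject₁ j with i ≟ opposite j
      ... | yes _ = ≡.refl
      ... | no  _ = ≡.refl

    cell-corner : ∀ (x : BruhatCell D D⁺) → ιᴹ (γ x) ≋ b₁ x · corner (w D′ D′⁺) · b₂ x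
    cell-corner x = ≋.trans (cell-bruhat D D⁺ x) (·-congʳ {C = b₂ x} (·-congˡ {A = b₁ x} w≋corner))

    module _ (x : BruhatCell D D⁺) where

      lowerLeft-bruhat : ιᴹ (ℤᴸ.lowerLeft (γ x)) ≋ lowerRight (b₁ x) · w D′ D′⁺ · upperLeft (b₂ x)
      lowerLeft-bruhat = ≋.trans (lowerLeft-cong (cell-corner x))
        (≋.trans (lowerLeft-· (corner (w D′ D′⁺)) (b₁-unipotent x) (b₂-unipotent x))
                 (·-congʳ {C = upperLeft (b₂ x)}
                   (·-congˡ {A = lowerRight (b₁ x)} (corner-init (w D′ D′⁺)))))

      -- Computed over `R`, where `γ x` and its block share the factors `b₁ x` and `b₂ x`, then
      -- brought back by injectivity of `ι`.
      lowerLeft-det : ℤᴹ.det (ℤᴸ.lowerLeft (γ x)) ≡ + 1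
      lowerLeft-det = ι-injective (let open ≈-Reasoning in begin
        ι (ℤᴹ.det (ℤᴸ.lowerLeft (γ x)))                         ≈⟨ ι-det (ℤᴸ.lowerLeft (γ x)) ⟩
        det (ιᴹ (ℤᴸ.lowerLeft (γ x)))                           ≈⟨ det-cong lowerLeft-bruhat ⟩
        det (lowerRight (b₁ x) · w D′ D′⁺ · upperLeft (b₂ x))
          ≈⟨ det-bruhat (w D′ D′⁺) (b₁-unipotent x) (b₂-unipotent x) ⟨
        det (b₁ x · corner (w D′ D′⁺) · b₂ x)                   ≈⟨ det-cong (cell-corner x) ⟨
        det (ιᴹ (γ x))                                          ≈⟨ ι-det (γ x) ⟨
        ι (ℤᴹ.det (γ x))                                        ≡⟨ ≡.cong ι (γ-det x) ⟩
        ι (+ 1)                                                 ∎)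

      restrict : BruhatCell D′ D′⁺
      restrict = record
        { γ            = ℤᴸ.lowerLeft (γ x)
        ; γ-det        = lowerLeft-det
        ; b₁           = lowerRight (b₁ x)
        ; b₂           = upperLeft (b₂ x)
        ; b₁-unipotent = tail-unipotent (b₁-unipotent x)
        ; b₂-unipotent = init-unipotent (b₂-unipotent x)
        ; bruhat       = ≋.trans lowerLeft-bruhat
            (·-congʳ {C = upperLeft (b₂ x)} (≋.sym (·-assoc (lowerRight (b₁ x)) (cᴰ D′ D′⁺) longWeyl)))
        }

    extend : BruhatCell D′ D′⁺ → BruhatCell D D⁺
    extend x = record
      { γ            = ℤᴸ.corner (γ x)
      ; γ-det        = ≡.trans (ℤᴸ.det-corner (γ x)) (γ-det x)
      ; b₁           = B₁
      ; b₂           = B₂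
      ; b₁-unipotent = extendˡ-unipotent _ (b₁-unipotent x)
      ; b₂-unipotent = extendʳ-unipotent (b₂ x) _ (b₂-unipotent x)
      ; bruhat       = let open ≋-Reasoning in begin
          ιᴹ (ℤᴸ.corner (γ x))                    ≈⟨ ιᴹ-corner (γ x) ⟩
          corner (ιᴹ (γ x))                       ≈⟨ corner-cong (cell-bruhat D′ D′⁺ x) ⟩
          corner (b₁ x · w D′ D′⁺ · b₂ x)         ≈⟨ corner-extendʳ (b₁ x · w D′ D′⁺) (b₂ x) ⟨
          corner (b₁ x · w D′ D′⁺) · B₂
            ≈⟨ ·-congʳ {C = B₂} (extendˡ-corner (b₁ x) (w D′ D′⁺)) ⟨
          B₁ · corner (w D′ D′⁺) · B₂             ≈⟨ ·-congʳ {C = B₂} (·-congˡ {A = B₁} w≋corner) ⟨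
          B₁ · w D D⁺ · B₂                        ≈⟨ ·-congʳ {C = B₂} (·-assoc B₁ (cᴰ D D⁺) longWeyl) ⟨
          B₁ · cᴰ D D⁺ · longWeyl · B₂            ∎
      }
      where
      B₁ = extendˡ (const 0#) (b₁ x)
      B₂ = extendʳ (b₂ x) (const 0#)

    restrict-∼ : ∀ x y → _∼_ D D⁺ x y → _∼_ D′ D′⁺ (restrict x) (restrict y)
    restrict-∼ x y = ℤᴸ.lowerLeft-≃ {A = γ x} {γ y}

    extend-∼ : ∀ x y → _∼_ D′ D′⁺ x y → _∼_ D D⁺ (extend x) (extend y)
    extend-∼ x y = ℤᴸ.corner-≃ {A = γ x} {γ y}

    restrict-extend : ∀ x → _∼_ D′ D′⁺ (restrict (extend x)) x
    restrict-extend x = ℤᴸ.≋⇒≃ {A = ℤᴸ.lowerLeft (ℤᴸ.corner (γ x))} (ℤᴸ.corner-init (γ x))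

    extend-restrict : ∀ x → _∼_ D D⁺ (extend (restrict x)) x
    extend-restrict x = ℤᴸ.corner-lowerLeft-≃ (γ x) B (γ-det x) (lowerLeft-det x) AB≋𝟙 BA≋𝟙
      where
      A = ℤᴸ.lowerLeft (γ x)
      B = ℤᴸ.adjugate A
      AB≋𝟙 : A ℤᴹ.· B ℤᴹ.≋ ℤᴸ.𝟙
      AB≋𝟙 i j = ≡.trans (ℤᴸ.·-adjugate A i j) (≡.cong (λ d → ℤᴹ.diag (λ _ → d) i j) (lowerLeft-det x))
      uwv : Matrix _
      uwv = lowerRight (b₁ x) · w D′ D′⁺ · upperLeft (b₂ x)
      -- This is A(BA) = (AB)A = A, carried to `R` with the leading `A` in factored form, the form
      -- in which it can be cancelled.
      A[BA]≋A : uwv · ιᴹ (B ℤᴹ.· A) ≋ uwv · ιᴹ ℤᴸ.𝟙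
      A[BA]≋A = let open ≋-Reasoning in begin
        uwv · ιᴹ (B ℤᴹ.· A)     ≈⟨ ·-congʳ {C = ιᴹ (B ℤᴹ.· A)} (lowerLeft-bruhat x) ⟨
        ιᴹ A · ιᴹ (B ℤᴹ.· A)    ≈⟨ ιᴹ-· A (B ℤᴹ.· A) ⟨
        ιᴹ (A ℤᴹ.· (B ℤᴹ.· A))  ≈⟨ ιᴹ-cong (ℤᴸ.·-cancel-inverseˡ {A = A} {B} A AB≋𝟙) ⟩
        ιᴹ A                    ≈⟨ lowerLeft-bruhat x ⟩
        uwv                     ≈⟨ ·-identityʳ uwv ⟨
        uwv · 𝟙                 ≈⟨ ·-congˡ {A = uwv} ιᴹ-𝟙 ⟨
        uwv · ιᴹ ℤᴸ.𝟙           ∎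
      -- Cancelling A over the field replaces the expansion along columns.
      BA≋𝟙 : B ℤᴹ.· A ℤᴹ.≋ ℤᴸ.𝟙
      BA≋𝟙 = ιᴹ-injective (bruhat-cancelˡ D′ D′⁺
        (tail-unipotent (b₁-unipotent x)) (init-unipotent (b₂-unipotent x)) A[BA]≋A)

    summand-extend : ∀ M N x → summand D D⁺ M N (extend x) C.≈ summand D′ D′⁺ (init M) (init N) x
    summand-extend M N x = ℂ.*-cong
      -- The first entry of `reverse M`, the last of `M`, meets the zero row of `extendˡ`; what
      -- remains of the sum is the one for `init M` by computation.
      (e-cong (0+≈ (zeroʳ _)))
      -- Here the last term goes: the last entry of `N` meets the zero column of `extendʳ`.
      (e-cong (trans (sum-init-last λ i → ι (N i) * b₂ (extend x) (inject₁ i) (suc i))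
        (trans (+0≈ (*0≈0 last≈0))
               (sum-cong-≋ {r} λ i → *-congˡ (extendʳ-init (b₂ x) (const 0#) (inject₁ i) (suc i))))))
      where
      last≈0 : extendʳ (b₂ x) (const 0#) (inject₁ (fromℕ r)) (suc (fromℕ r)) ≈ 0#
      last≈0 = extendʳ-last (b₂ x) _ (fromℕ r)

    -- The enumerations are unrelated, so `extend` of a representative in `X′` is only equivalent to
    -- one in `X`. The permutation pairs these up, and invariance of the summand absorbs the
    -- difference.
    S-init : ∀ M N (X : Enumeration D D⁺) (X′ : Enumeration D′ D′⁺) →
             S D D⁺ X M N C.≈ S D′ D′⁺ X′ (init M) (init N)
    S-init M N X X′ = ℂ.trans
      (sumᶜ-permute (summand D D⁺ M N ∘ X.rep) π)
      (sumᶜ-cong {X′.size} λ j → ℂ.trans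
        (ℂ.sym (summand-∼ D D⁺ M N (X.rep (π ⟨$⟩ʳ j)) (extend (X′.rep j)) (π-∼ j)))
        (summand-extend M N (X′.rep j)))
      where
      module X = Enumeration X
      module X′ = Enumeration X′
      open Transversals {_∼ᵃ_ = _∼_ D D⁺} {_∼ᵇ_ = _∼_ D′ D′⁺} (∼-trans D D⁺) (∼-trans D′ D′⁺)
        {f = X.rep} {g = X′.rep} X.bijective X′.bijective
        restrict extend restrict-∼ extend-∼ extend-restrict restrict-extend
        renaming (permute to π; permute-∼ to π-∼)

open import Data.Nat.Base using (_+_)

proposition3p7 : ∀ {c ℓ₁ ℓ₂ c′ ℓ₁′ ℓ₂′ : Level} (E : Exponential c ℓ₁ ℓ₂ c′ ℓ₁′ ℓ₂′) →
    let open Kloosterman E in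
    (k : ℕ) → let n-1 = 2 + k in
    (M N : Vector ℤ n-1) (D : Vector ℕ n-1) (D⁺ : ∀ i → NonZero (D i)) →
    last D ≡ 1 →
    (X : Enumeration D D⁺) (X′ : Enumeration (init D) (λ i → D⁺ (inject₁ i))) →
    S D D⁺ X M N C.≈ S (init D) (λ i → D⁺ (inject₁ i)) X′ (init M) (init N)
proposition3p7 E k M N D D⁺ last≡1 X X′ = S-init E D D⁺ last≡1 M N X X′
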